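{- A rational transduction $f$ is aperiodic (i.e. $\mathcal{A}p$-rational) if and only if its canonical bimachine $\mathcal B_f$ is aperiodic, i.e. both $\mathit{Left}_f(\mathcal R_f)$ and $\mathcal R_f$ have aperiodic transition congruences.
   Context: A congruence $\sim$ on $\Sigma^*$ is aperiodic if there is $n$ with $w^n\sim w^{n+1}$ for all $w$. For an automaton $\mathcal A=(Q,\Delta,I,F)$ (left or right), $u\approx_{\mathcal A}v$ iff for all $p,q$ there is a run on $u$ from $p$ to $q$ iff on $v$; $\mathcal A$ is aperiodic if $\approx_{\mathcal A}$ is aperiodic. A transduction is $\mathcal{A}p$-rational if realized by a functional transducer (automaton with outputs on transitions, initial and final outputs) with aperiodic underlying automaton. Notation: $u^{ -1}v$ is the $v'$ with $uv'=v$; $\bigwedge L$ is the longest common prefix ($\bigwedge\emptyset=\varepsilon$); $d(u,v)=|u|+|v|-2|u\wedge v|$. Define $u\leftharpoonup_fv$ iff for all $w$, $wu\in\mathrm{dom}f\Leftrightarrow wv\in\mathrm{dom}f$ and $\sup\{d(f(wu),f(wv)):wu\in\mathrm{dom}f\}<\infty$. $\mathcal R_f$ is the right automaton (backward deterministic, read right to left) with states $\Sigma^*/{\leftharpoonup_f}$, transitions $([\sigma w],\sigma,[w])$, initial $[\varepsilon]$, finals $\{[w]:w\in\mathrm{dom}f\}$; write $[w]_{\mathcal R_f}$ for the class. Let $\widehat f_{[w]}(u)=\bigwedge\{f(uv):v\leftharpoonup_fw,uv\in\mathrm{dom}f\}$ and $u\sim_Lv$ iff for all $w$, $uw\in\mathrm{dom}f\Leftrightarrow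 vw\in\mathrm{dom}f$ and (if so) $\widehat f_{[w]}(u)^{ -1}f(uw)=\widehat f_{[w]}(v)^{ -1}f(vw)$. $\mathit{Left}_f(\mathcal R_f)$ is the deterministic automaton on $\Sigma^*/{\sim_L}$ with transitions $([u],\sigma,[u\sigma])$, initial $[\varepsilon]$, finals $\{[u]:u\in\mathrm{dom}f\}$. The canonical bimachine is $\mathcal B_f=(\mathit{Left}_f(\mathcal R_f),\mathcal R_f,\omega_f,\lambda_f,\rho_f)$ with $\omega_f([u]_L,\sigma,[w])=\widehat f_{[\sigma w]}(u)^{ -1}\widehat f_{[w]}(u\sigma)$, $\lambda_f([w])=\widehat f_{[w]}(\varepsilon)$, $\rho_f([u]_L)=\widehat f_{[\varepsilon]}(u)^{ -1}f(u)$; it realizes $f$. -}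

module Defs where

open import Level using (0ℓ)
open import Data.Nat.Base using (ℕ; zero; suc; _+_; _*_; _∸_; _≤_; z≤n; s≤s)
import Data.Nat.Properties as ℕₚ
open import Data.Fin.Base using (Fin)
import Data.Fin.Properties as Finₚ
open import Data.List.Base using (List; []; _∷_; _++_; [_]; length; concat; replicate)
open import Data.List.Relation.Binary.Prefix.Heterogeneous using (Prefix)
open import Data.Maybe.Base using (Maybe; just)
open import Data.Product.Base using (Σ; ∃; ∃-syntax; _×_; _,_; proj₁; proj₂)
open import Data.Sum.Base using (_⊎_)
open import Function.Bundles using (_⇔_; mk⇔; Equivalence)
open import Function.Properties.Equivalence using (⇔-isEquivalence)
open import Relation.Nullary using (¬_; yes; no)
open import Data.Empty using (⊥-elim)
open import Relation.Binary.Core using (Rel)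
open import Relation.Binary.Bundles using (Setoid)
open import Relation.Binary.Structures using (IsEquivalence)
open import Relation.Binary.Definitions using (_Respects_)
open import Relation.Binary.PropositionalEquality
  using (_≡_; refl; sym; trans; cong; cong₂; subst; subst₂; setoid)

------------------------------------------------------------------------
-- The finite alphabets are Fin k (input) and Fin l (output).

Word : ℕ → Set
Word k = List (Fin k)

_^_ : ∀ {k} → Word k → ℕ → Word k
w ^ n = concat (replicate n w)

_∧_ : ∀ {l} → Word l → Word l → Word l
[] ∧ v = []
(a ∷ u) ∧ [] = []
(a ∷ u) ∧ (b ∷ v) with a Finₚ.≟ b
... | yes _ = a ∷ (u ∧ v)
... | no  _ = []

-- The subtraction never truncates, since u ∧ v is a prefix of both words.
dist : ∀ {l} → Word l → Word l → ℕ
dist u v = (length u + length v) ∸ 2 * length (u ∧ v)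

_⊑_ : ∀ {l} → Rel (Word l) 0ℓ
_⊑_ = Prefix _≡_

-- p is ⋀ L, with the convention ⋀ ∅ = ε.
IsLCP : ∀ {l} → (Word l → Set) → Word l → Set
IsLCP L p =
    (∃ L × (∀ x → L x → p ⊑ x) × (∀ z → (∀ x → L x → z ⊑ x) → z ⊑ p))
  ⊎ (¬ ∃ L × p ≡ [])

AperiodicRelation : ∀ {k} → Rel (Word k) 0ℓ → Set
AperiodicRelation _∼_ = ∃[ n ] (∀ w → (w ^ n) ∼ (w ^ suc n))

------------------------------------------------------------------------
-- States form a setoid, so that quotients of Word k can serve
-- as state sets.  The same record is used for left and right automata: a
-- right automaton reads its input from right to left, so its runs are
-- the same paths, with the initial state at the right end.

record Automaton (k : ℕ) : Set₁ where
  field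
    States : Setoid 0ℓ 0ℓ
  open Setoid States public using (_≈_) renaming (Carrier to State)
  field
    Δ      : State → Fin k → State → Set
    Δ-resp : ∀ {p p′ σ q q′} → p ≈ p′ → q ≈ q′ → Δ p σ q → Δ p′ σ q′
    I      : State → Set
    I-resp : I Respects _≈_
    F      : State → Set
    F-resp : F Respects _≈_

  data Run : State → Word k → State → Set where
    done : ∀ {p q} → p ≈ q → Run p [] q
    step : ∀ {p σ r u q} → Δ p σ r → Run r u q → Run p (σ ∷ u) q

TransitionCongruence : ∀ {k} → Automaton k → Rel (Word k) 0ℓ
TransitionCongruence A u v = ∀ p q → Run p u q ⇔ Run p v q
  where open Automaton A

AperiodicAutomaton : ∀ {k} → Automaton k → Set
AperiodicAutomaton A = AperiodicRelation (TransitionCongruence A)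

------------------------------------------------------------------------
-- A transition, initial state or final state is present
-- exactly when its output is `just` a word.

record Transducer (k l : ℕ) : Set where
  field
    size  : ℕ
    δ     : Fin size → Fin k → Fin size → Maybe (Word l)
    init  : Fin size → Maybe (Word l)
    final : Fin size → Maybe (Word l)

  data OutputRun : Fin size → Word k → Word l → Fin size → Set where
    done : ∀ {p} → OutputRun p [] [] p
    step : ∀ {p σ o r u x q} → δ p σ r ≡ just o → OutputRun r u x q →
           OutputRun p (σ ∷ u) (o ++ x) q

  ⟦_⟧ : Word k → Word l → Set
  ⟦_⟧ u y = ∃[ p ] ∃[ q ] ∃[ i ] ∃[ x ] ∃[ t ]
    (init p ≡ just i × OutputRun p u x q × final q ≡ just t × y ≡ i ++ x ++ t)

  underlying : Automaton k
  underlying = record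
    { States = setoid (Fin size)
    ; Δ      = λ p σ q → ∃[ o ] δ p σ q ≡ just o
    ; Δ-resp = λ { refl refl t → t }
    ; I      = λ p → ∃[ o ] init p ≡ just o
    ; I-resp = λ { refl i → i }
    ; F      = λ p → ∃[ o ] final p ≡ just o
    ; F-resp = λ { refl i → i }
    }

-- Transductions are partial functions, given by their graphs.
record Transduction (k l : ℕ) : Set₁ where
  field
    graph      : Word k → Word l → Set
    functional : ∀ {u x y} → graph u x → graph u y → x ≡ y

  Dom : Word k → Set
  Dom u = ∃ (graph u)

FunctionalTransducer : ∀ {k l} → Transducer k l → Set
FunctionalTransducer T = ∀ {u x y} → ⟦ u ⟧ x → ⟦ u ⟧ y → x ≡ y
  where open Transducer T

Realizes : ∀ {k l} → Transducer k l → Transduction k l → Set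
Realizes T f = ∀ u y → Transducer.⟦_⟧ T u y ⇔ Transduction.graph f u y

Rational : ∀ {k l} → Transduction k l → Set
Rational {k} {l} f =
  Σ (Transducer k l) λ T → FunctionalTransducer T × Realizes T f

ApRational : ∀ {k l} → Transduction k l → Set
ApRational {k} {l} f =
  Σ (Transducer k l) λ T →
    FunctionalTransducer T × Realizes T f × AperiodicAutomaton (Transducer.underlying T)

-- The three output functions are given by their graphs.
record Bimachine (k l : ℕ) : Set₁ where
  field
    left  : Automaton k
    right : Automaton k
    ω     : Automaton.State left → Fin k → Automaton.State right → Word l → Set
    λᵣ    : Automaton.State right → Word l → Set
    ρₗ    : Automaton.State left → Word l → Set

AperiodicBimachine : ∀ {k l} → Bimachine k l → Set
AperiodicBimachine B =
  AperiodicAutomaton (Bimachine.left B) × AperiodicAutomaton (Bimachine.right B)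

------------------------------------------------------------------------
-- dist is a metric (needed for transitivity of ↼ below).

module Distance where
  open import Data.Nat.Solver using (module +-*-Solver)
  open +-*-Solver using (solve; _:+_; _:*_; _:=_; con)

  dist-refl : ∀ {l} (u : Word l) → dist u u ≡ 0
  dist-∷ : ∀ {l} (a : Fin l) u v → dist (a ∷ u) (a ∷ v) ≡ dist u v

  dist-∷ a u v with a Finₚ.≟ a
  ... | no a≢a = ⊥-elim (a≢a refl)
  ... | yes _ = trans
    (cong₂ _∸_
      (solve 2 (λ m n → (con 1 :+ m) :+ (con 1 :+ n) := con 2 :+ (m :+ n)) refl (length u) (length v))
      (solve 1 (λ c → con 2 :* (con 1 :+ c) := con 2 :+ con 2 :* c) refl (length (u ∧ v))))
    (ℕₚ.[m+n]∸[m+o]≡n∸o 2 (length u + length v) (2 * length (u ∧ v)))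

  dist-refl []      = refl
  dist-refl (a ∷ u) = trans (dist-∷ a u u) (dist-refl u)

  dist-≢ : ∀ {l} {a b : Fin l} u v → ¬ a ≡ b →
           dist (a ∷ u) (b ∷ v) ≡ suc (length u) + suc (length v)
  dist-≢ {a = a} {b} u v a≢b with a Finₚ.≟ b
  ... | yes a≡b = ⊥-elim (a≢b a≡b)
  ... | no  _   = refl

  dist-[]ʳ : ∀ {l} (u : Word l) → dist u [] ≡ length u
  dist-[]ʳ []      = refl
  dist-[]ʳ (a ∷ u) = ℕₚ.+-identityʳ _

  dist-sym : ∀ {l} (u v : Word l) → dist u v ≡ dist v u
  dist-sym []      v       = sym (dist-[]ʳ v)
  dist-sym (a ∷ u) []      = dist-[]ʳ (a ∷ u)
  dist-sym (a ∷ u) (b ∷ v) = go (a Finₚ.≟ b)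
    where
    go : _ → dist (a ∷ u) (b ∷ v) ≡ dist (b ∷ v) (a ∷ u)
    go (yes refl) = trans (dist-∷ a u v) (trans (dist-sym u v) (sym (dist-∷ a v u)))
    go (no a≢b) = trans (dist-≢ u v a≢b)
      (trans (ℕₚ.+-comm (suc (length u)) (suc (length v)))
             (sym (dist-≢ v u (λ e → a≢b (sym e)))))

  dist-≤ : ∀ {l} (u v : Word l) → dist u v ≤ length u + length v
  dist-≤ u v = ℕₚ.m∸n≤m _ (2 * length (u ∧ v))

  length-≤ : ∀ {l} (u v : Word l) → length v ≤ length u + dist u v
  length-≤ []      v       = ℕₚ.≤-refl
  length-≤ (a ∷ u) []      = z≤n
  length-≤ (a ∷ u) (b ∷ v) = go (a Finₚ.≟ b)
    where
    go : _ → length (b ∷ v) ≤ length (a ∷ u) + dist (a ∷ u) (b ∷ v)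
    go (yes refl) = subst (λ m → suc (length v) ≤ suc (length u) + m)
      (sym (dist-∷ a u v)) (s≤s (length-≤ u v))
    go (no a≢b) = subst (λ m → suc (length v) ≤ suc (length u) + m)
      (sym (dist-≢ u v a≢b))
      (ℕₚ.≤-trans (ℕₚ.m≤n+m _ (suc (length u))) (ℕₚ.m≤n+m _ (suc (length u))))

  dist-triangle : ∀ {l} (u v w : Word l) → dist u w ≤ dist u v + dist v w
  dist-triangle []      v w = length-≤ v w
  dist-triangle (a ∷ u) v [] = subst₂ _≤_ (sym (dist-[]ʳ (a ∷ u)))
    (trans (ℕₚ.+-comm (length v) _)
      (cong₂ _+_ (dist-sym v (a ∷ u)) (sym (dist-[]ʳ v))))
    (length-≤ v (a ∷ u))
  dist-triangle (a ∷ u) [] (c ∷ w) = ℕₚ.≤-trans (dist-≤ (a ∷ u) (c ∷ w))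
    (ℕₚ.+-monoˡ-≤ _ (ℕₚ.≤-reflexive (sym (dist-[]ʳ (a ∷ u)))))
  dist-triangle (a ∷ u) (b ∷ v) (c ∷ w) = go (a Finₚ.≟ b) (b Finₚ.≟ c)
    where
    open ℕₚ.≤-Reasoning
    A = a ∷ u ; B = b ∷ v ; C = c ∷ w
    go : _ → _ → dist A C ≤ dist A B + dist B C
    go (yes refl) (yes refl) = begin
      dist A C              ≡⟨ dist-∷ a u w ⟩
      dist u w              ≤⟨ dist-triangle u v w ⟩
      dist u v + dist v w   ≡⟨ cong₂ _+_ (dist-∷ a u v) (dist-∷ a v w) ⟨
      dist A B + dist B C   ∎
    go (no a≢b) _ = begin
      dist A C                          ≤⟨ dist-≤ A C ⟩
      length A + length C               ≤⟨ ℕₚ.+-monoʳ-≤ (length A) (length-≤ B C) ⟩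
      length A + (length B + dist B C)  ≡⟨ ℕₚ.+-assoc (length A) _ _ ⟨
      length A + length B + dist B C    ≡⟨ cong (_+ dist B C) (dist-≢ u v a≢b) ⟨
      dist A B + dist B C               ∎
    go (yes _) (no b≢c) = begin
      dist A C                          ≤⟨ dist-≤ A C ⟩
      length A + length C               ≤⟨ ℕₚ.+-monoˡ-≤ (length C) (length-≤ B A) ⟩
      length B + dist B A + length C    ≡⟨ cong (λ d → length B + d + length C) (dist-sym B A) ⟩
      length B + dist A B + length C    ≡⟨ cong (_+ length C) (ℕₚ.+-comm (length B) _) ⟩
      dist A B + length B + length C    ≡⟨ ℕₚ.+-assoc (dist A B) _ _ ⟩
      dist A B + (length B + length C)  ≡⟨ cong (dist A B +_) (dist-≢ v w b≢c) ⟨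
      dist A B + dist B C               ∎

open Distance public

module _ {k l : ℕ} (f : Transduction k l) where
  open Transduction f
  private module E {A B : Set} (e : A ⇔ B) = Equivalence e

  -- Close u v  means  u ↼_f v.
  Close : Rel (Word k) 0ℓ
  Close u v = (∀ w → Dom (w ++ u) ⇔ Dom (w ++ v))
            × (∃[ B ] (∀ w x y → graph (w ++ u) x → graph (w ++ v) y → dist x y ≤ B))

  Close-isEquivalence : IsEquivalence Close
  Close-isEquivalence = record
    { refl  = λ {u} → (λ w → mk⇔ (λ d → d) (λ d → d))
                    , 0 , λ w x y fx fy → ℕₚ.≤-reflexive
                        (trans (cong (dist x) (functional fy fx)) (dist-refl x))
    ; sym   = λ { (d , B , b) →
                  (λ w → mk⇔ (E.from (d w)) (E.to (d w)))
                , B , λ w x y fx fy → subst (_≤ B) (dist-sym y x) (b w y x fy fx) }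
    ; trans = λ { (d , B , b) (d′ , B′ , b′) →
                  (λ w → mk⇔ (λ z → E.to (d′ w) (E.to (d w) z))
                             (λ z → E.from (d w) (E.from (d′ w) z)))
                , B + B′ , λ w x y fx fy →
                    let (m , fm) = E.to (d w) (x , fx) in
                    ℕₚ.≤-trans (dist-triangle x m y)
                      (ℕₚ.+-mono-≤ (b w x m fx fm) (b′ w m y fm fy)) }
    }

  Close-setoid : Setoid 0ℓ 0ℓ
  Close-setoid = record { isEquivalence = Close-isEquivalence }

  private
    module C = IsEquivalence Close-isEquivalence

  canonicalRight : Automaton k
  canonicalRight = record
    { States = Close-setoid
    ; Δ      = λ p σ q → ∃[ w ] (Close p (σ ∷ w) × Close q w)
    ; Δ-resp = λ { pp qq (w , a , b) → w , C.trans (C.sym pp) a , C.trans (C.sym qq) b }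
    ; I      = λ p → Close p []
    ; I-resp = λ pp a → C.trans (C.sym pp) a
    ; F      = λ p → ∃[ w ] (Close p w × Dom w)
    ; F-resp = λ { pp (w , a , d) → w , C.trans (C.sym pp) a , d }
    }

  -- HatF w u p  means  f̂_[w](u) = p.
  HatF : Word k → Word k → Word l → Set
  HatF w u = IsLCP (λ y → ∃[ v ] (Close v w × graph (u ++ v) y))

  -- Residual u w r  means  uw ∈ dom f  and  f̂_[w](u)⁻¹ f(uw) = r.
  Residual : Word k → Word k → Word l → Set
  Residual u w r = ∃[ p ] (HatF w u p × graph (u ++ w) (p ++ r))

  -- Residual is single-valued, so equal residuals are stated as equal graphs.
  SimL : Rel (Word k) 0ℓ
  SimL u v = ∀ w → (Dom (u ++ w) ⇔ Dom (v ++ w))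
                 × (∀ r → Residual u w r ⇔ Residual v w r)

  SimL-isEquivalence : IsEquivalence SimL
  SimL-isEquivalence = record
    { refl  = λ w → ⇔.refl , λ r → ⇔.refl
    ; sym   = λ s w → ⇔.sym (proj₁ (s w)) , λ r → ⇔.sym (proj₂ (s w) r)
    ; trans = λ s t w → ⇔.trans (proj₁ (s w)) (proj₁ (t w))
                      , λ r → ⇔.trans (proj₂ (s w) r) (proj₂ (t w) r)
    }
    where module ⇔ = IsEquivalence (⇔-isEquivalence {0ℓ})

  SimL-setoid : Setoid 0ℓ 0ℓ
  SimL-setoid = record { isEquivalence = SimL-isEquivalence }

  private
    module L = IsEquivalence SimL-isEquivalence

  canonicalLeft : Automaton k
  canonicalLeft = record
    { States = SimL-setoid
    ; Δ      = λ p σ q → ∃[ u ] (SimL p u × SimL q (u ++ [ σ ]))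
    ; Δ-resp = λ { pp qq (w , a , b) → w , L.trans (L.sym pp) a , L.trans (L.sym qq) b }
    ; I      = λ p → SimL p []
    ; I-resp = λ pp a → L.trans (L.sym pp) a
    ; F      = λ p → ∃[ u ] (SimL p u × Dom u)
    ; F-resp = λ { pp (w , a , d) → w , L.trans (L.sym pp) a , d }
    }

  -- As for the transitions, the graphs range over all representatives u, w
  -- of the given classes, which makes them invariant on the quotients.
  canonicalBimachine : Bimachine k l
  canonicalBimachine = record
    { left  = canonicalLeft
    ; right = canonicalRight
    ; ω     = λ p σ q o → ∃[ u ] ∃[ w ] (SimL p u × Close q w ×
                (∃[ x ] (HatF (σ ∷ w) u x × HatF w (u ++ [ σ ]) (x ++ o))))
    ; λᵣ    = λ q o → ∃[ w ] (Close q w × HatF w [] o)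
    ; ρₗ    = λ p o → ∃[ u ] (SimL p u ×
                (∃[ x ] (HatF [] u x × graph u (x ++ o))))
    }

{-# OPTIONS --safe #-}

-- The relation ∼_L is first freed from longest common prefixes: u ∼_L v iff u and v have the same
-- right contexts in dom f and, whenever w₁ ↼ w₂, the free-group elements f(uw₁)⁻¹f(uw₂) and
-- f(vw₁)⁻¹f(vw₂) agree (SimD below).  Runs of the two canonical automata then amount to
-- p u ∼_L q and p ↼ u q.
--
-- If a transducer for f is aperiodic of exponent n, then wⁿq ↼ wⁿ⁺¹q because both words are
-- accepted from the same states.  For ∼_L, two runs on a large power of w share a loop on some wʲ
-- with j ≥ n, which may be replaced by a loop on wʲ⁺¹.  As ↼ bounds distances, pumping either loop
-- bounds the distance of the outputs, so by combinatorics on words neither loop changes their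
-- delay.
--
-- Conversely, pumping bounds the length of the words that must be inspected to decide ↼ and ∼_L,
-- to find representatives of their classes and to compute f̂.  The canonical bimachine can hence be
-- turned into a finite transducer whose states are pairs of short representatives, and whose
-- runs on nonempty words are given by the two congruences, so it inherits their aperiodicity.

module Submission where

open import Data.Empty using (⊥-elim)
open import Data.Fin.Base using (Fin; toℕ; combine) renaming (zero to fzero; suc to fsuc)
import Data.Fin.Properties as Finₚ
open import Data.List.Base
  using (List; []; _∷_; _++_; [_]; length; map; filter; concatMap; allFin; cartesianProductWith;
         reverse; take; drop; lookup)
open import Data.List.Membership.Propositional using (_∈_; find; lose)
open import Data.List.Membership.Propositional.Properties
  using (∈-map⁺; ∈-map⁻; ∈-filter⁺; ∈-filter⁻; ∈-concatMap⁺; ∈-concatMap⁻; ∈-allFin;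
         ∈-cartesianProductWith⁺; ∈-cartesianProductWith⁻)
open import Data.List.Properties
  using (++-assoc; ++-identityʳ; ++-cancelˡ; ++-cancelʳ; length-++; length-drop; take++drop≡id;
         reverse-++; reverse-involutive; ≡-dec; ∷-injectiveˡ; ∷-injectiveʳ)
open import Data.List.Relation.Binary.Prefix.Heterogeneous using ([]; _∷_)
import Data.List.Relation.Unary.All as All
open import Data.List.Relation.Unary.Any as Any using (here; there)
open import Data.List.Relation.Unary.Any.Properties using (lookup-index)
open import Data.Maybe.Base using (Maybe; just; nothing)
open import Data.Nat.Base
  using (ℕ; zero; suc; _+_; _*_; _∸_; _≤_; _<_; _⊔_; z≤n; s≤s; >-nonZero)
open import Data.Nat.Induction using (<-wellFounded)
import Data.Nat.Properties as ℕₚ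
open import Data.Product.Base using (Σ; ∃; ∃-syntax; _×_; _,_; proj₁; proj₂)
open import Data.Sum.Base using (_⊎_; inj₁; inj₂)
open import Data.Unit.Base using (⊤; tt)
open import Function.Base using (case_of_)
open import Function.Bundles using (_⇔_; mk⇔; Equivalence)
open import Function.Properties.Equivalence using (⇔-isEquivalence)
import Induction.WellFounded as WF
open import Level using (0ℓ)
import Relation.Binary.Construct.On as On
open import Relation.Binary.PropositionalEquality
  using (_≡_; refl; sym; trans; cong; cong₂; subst; subst₂; module ≡-Reasoning)
open import Relation.Binary.Structures using (IsEquivalence)
open import Relation.Nullary using (¬_; Dec; yes; no)
open import Relation.Nullary.Decidable
  using (map′; _×-dec_; _→-dec_; decidable-stable; ¬¬-excluded-middle)
open import Defs

-- The obstacle is constructivity: `HatF` and both congruences quantify over all words, yet the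
-- finite transducer has to compute with them. Delays replace longest common prefixes because they
-- can be compared (`sd?`) and composed in two directions (`sd-trans`, `sd-transᶜ`) without forming
-- inverses. The decision procedures must not be circular. Short representatives come first
-- (`left-rep`, `right-rep`), from relations of finite index that are read off a given transducer
-- and refine the canonical congruences. Then `close?` tests contexts up to left representatives,
-- and `simD?` and `common?` call `close?`. What they decide depends on f alone, so any transducer
-- for f may serve. For ∼_L and f̂ one loop is too little: agreement after deleting a single loop
-- does not imply agreement before. With two consecutive loops, the outputs with neither, with the
-- first only and with the second only control the output with both. States of the finite transducer
-- are words, not classes, so several may stand for the same pair of classes. Runs on the empty word
-- join a state only to itself and are therefore treated apart.

open Equivalence using (to; from)

-- Words

module _ {k : ℕ} where

  _≟ʷ_ : (u v : Word k) → Dec (u ≡ v)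
  _≟ʷ_ = ≡-dec Finₚ._≟_

  ++-compare : ∀ (u u′ : Word k) {v v′} → u ++ v ≡ u′ ++ v′ →
    (∃[ r ] (u ≡ u′ ++ r × v′ ≡ r ++ v)) ⊎ (∃[ r ] (u′ ≡ u ++ r × v ≡ r ++ v′))
  ++-compare []      u′       refl = inj₂ (u′ , refl , refl)
  ++-compare (a ∷ u) []       refl = inj₁ (a ∷ u , refl , refl)
  ++-compare (a ∷ u) (b ∷ u′) eq
    with refl ← ∷-injectiveˡ eq | ++-compare u u′ (∷-injectiveʳ eq)
  ... | inj₁ (r , refl , eq′) = inj₁ (r , refl , eq′)
  ... | inj₂ (r , refl , eq′) = inj₂ (r , refl , eq′)

  ⊑-++ : ∀ (u v : Word k) → u ⊑ (u ++ v)
  ⊑-++ []      v = []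
  ⊑-++ (a ∷ u) v = refl ∷ ⊑-++ u v

  ⊑⇒++ : ∀ {u v : Word k} → u ⊑ v → ∃[ r ] v ≡ u ++ r
  ⊑⇒++ []         = _ , refl
  ⊑⇒++ (refl ∷ p) with r , refl ← ⊑⇒++ p = r , refl

  ++⇒⊑ : ∀ {u v : Word k} {r} → v ≡ u ++ r → u ⊑ v
  ++⇒⊑ {u} {r = r} refl = ⊑-++ u r

  ⊑-trans : ∀ {u v w : Word k} → u ⊑ v → v ⊑ w → u ⊑ w
  ⊑-trans []         q          = []
  ⊑-trans (refl ∷ p) (refl ∷ q) = refl ∷ ⊑-trans p q

  ⊑-antisym : ∀ {u v : Word k} → u ⊑ v → v ⊑ u → u ≡ v
  ⊑-antisym []         []         = refl
  ⊑-antisym (refl ∷ p) (_ ∷ q) = cong (_ ∷_) (⊑-antisym p q)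

  ⊑-++⁺ : ∀ (w : Word k) {u v} → u ⊑ v → (w ++ u) ⊑ (w ++ v)
  ⊑-++⁺ []      p = p
  ⊑-++⁺ (a ∷ w) p = refl ∷ ⊑-++⁺ w p

  ⊑-++⁻ : ∀ (w : Word k) {u v} → (w ++ u) ⊑ (w ++ v) → u ⊑ v
  ⊑-++⁻ []      p       = p
  ⊑-++⁻ (a ∷ w) (_ ∷ p) = ⊑-++⁻ w p

  ⊑-length : ∀ {u v w : Word k} → u ⊑ w → v ⊑ w → length u ≤ length v → u ⊑ v
  ⊑-length []         q          _       = []
  ⊑-length (refl ∷ p) (refl ∷ q) (s≤s h) = refl ∷ ⊑-length p q h

  ⊑-length-≡ : ∀ {u v w : Word k} → u ⊑ w → v ⊑ w → length u ≡ length v → u ≡ v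
  ⊑-length-≡ p q eq = ⊑-antisym (⊑-length p q (ℕₚ.≤-reflexive eq))
                                (⊑-length q p (ℕₚ.≤-reflexive (sym eq)))

  ⊑-compare : ∀ {u v w : Word k} → u ⊑ w → v ⊑ w → u ⊑ v ⊎ v ⊑ u
  ⊑-compare {u} {v} p q with ℕₚ.≤-total (length u) (length v)
  ... | inj₁ h = inj₁ (⊑-length p q h)
  ... | inj₂ h = inj₂ (⊑-length q p h)

  _⊑?_ : (u v : Word k) → Dec (u ⊑ v)
  []      ⊑? v       = yes []
  (a ∷ u) ⊑? []      = no λ ()
  (a ∷ u) ⊑? (b ∷ v) = map′ (λ { (refl , p) → refl ∷ p }) (λ { (e ∷ p) → e , p })
                            ((a Finₚ.≟ b) ×-dec (u ⊑? v))

  suffix? : (s u : Word k) → Dec (∃[ e ] u ≡ e ++ s)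
  suffix? s u with u ≟ʷ s
  suffix? s u       | yes refl = yes ([] , refl)
  suffix? s []      | no u≢s   = no λ { ([] , eq) → u≢s eq ; (_ ∷ _ , ()) }
  suffix? s (a ∷ u) | no u≢s   = map′ (λ { (e , refl) → a ∷ e , refl })
    (λ { ([] , eq) → ⊥-elim (u≢s eq) ; (_ ∷ e , refl) → e , refl }) (suffix? s u)

  ^-+ : ∀ (w : Word k) m n → w ^ (m + n) ≡ (w ^ m) ++ (w ^ n)
  ^-+ w zero    n = refl
  ^-+ w (suc m) n = trans (cong (w ++_) (^-+ w m n)) (sym (++-assoc w (w ^ m) (w ^ n)))

  ^-suc : ∀ (w : Word k) n → w ^ suc n ≡ (w ^ n) ++ w
  ^-suc w zero    = ++-identityʳ w
  ^-suc w (suc n) = trans (cong (w ++_) (^-suc w n)) (sym (++-assoc w (w ^ n) w))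

  ^-* : ∀ (w : Word k) m n → (w ^ m) ^ n ≡ w ^ (n * m)
  ^-* w m zero    = refl
  ^-* w m (suc n) = trans (cong ((w ^ m) ++_) (^-* w m n)) (sym (^-+ w m (n * m)))

  length-^ : ∀ (w : Word k) n → length (w ^ n) ≡ n * length w
  length-^ w zero    = refl
  length-^ w (suc n) = trans (length-++ w) (cong (length w +_) (length-^ w n))

  -- The maximal common prefix, stated through factorizations so that it can be reversed.
  MaximalPrefix : (u v c x y : Word k) → Set
  MaximalPrefix u v c x y = u ≡ c ++ x × v ≡ c ++ y ×
    (∀ d s t → u ≡ d ++ s → v ≡ d ++ t → ∃[ r ] (c ≡ d ++ r × s ≡ r ++ x × t ≡ r ++ y))

  maximalPrefix : ∀ u v → ∃[ c ] ∃[ x ] ∃[ y ] MaximalPrefix u v c x y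
  maximalPrefix [] v = [] , [] , v , refl , refl ,
    λ { [] s t refl refl → [] , refl , refl , refl }
  maximalPrefix (a ∷ u) [] = [] , a ∷ u , [] , refl , refl ,
    λ { [] s t refl refl → [] , refl , refl , refl }
  maximalPrefix (a ∷ u) (b ∷ v) with a Finₚ.≟ b | maximalPrefix u v
  ... | no a≢b | _ = [] , a ∷ u , b ∷ v , refl , refl ,
    λ { [] s t refl refl → [] , refl , refl , refl
      ; (_ ∷ d) s t refl refl → ⊥-elim (a≢b refl) }
  ... | yes refl | c , x , y , refl , refl , m = a ∷ c , x , y , refl , refl , max
    where
    max : ∀ d s t → a ∷ c ++ x ≡ d ++ s → a ∷ c ++ y ≡ d ++ t →
          ∃[ r ] (a ∷ c ≡ d ++ r × s ≡ r ++ x × t ≡ r ++ y)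
    max []      s t refl refl = a ∷ c , refl , refl , refl
    max (b ∷ d) s t e₁   e₂
      with refl ← ∷-injectiveˡ e₁
      with r , refl , es , et ← m d s t (∷-injectiveʳ e₁) (∷-injectiveʳ e₂)
      = r , refl , es , et

  MaximalSuffix : (u v x y c : Word k) → Set
  MaximalSuffix u v x y c = u ≡ x ++ c × v ≡ y ++ c ×
    (∀ d s t → u ≡ s ++ d → v ≡ t ++ d → ∃[ r ] (c ≡ r ++ d × s ≡ x ++ r × t ≡ y ++ r))

  maximalSuffix : ∀ u v → ∃[ x ] ∃[ y ] ∃[ c ] MaximalSuffix u v x y c
  maximalSuffix u v with c , x , y , eu , ev , m ← maximalPrefix (reverse u) (reverse v) =
    reverse x , reverse y , reverse c , back u c x eu , back v c y ev , max
    where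
    back : ∀ u c x → reverse u ≡ c ++ x → u ≡ reverse x ++ reverse c
    back u c x e = trans (sym (reverse-involutive u)) (trans (cong reverse e) (reverse-++ c x))

    max : ∀ d s t → u ≡ s ++ d → v ≡ t ++ d →
          ∃[ r ] (reverse c ≡ r ++ d × s ≡ reverse x ++ r × t ≡ reverse y ++ r)
    max d s t e₁ e₂
      with r , ec , es , et ← m (reverse d) (reverse s) (reverse t)
                              (trans (cong reverse e₁) (reverse-++ s d))
                              (trans (cong reverse e₂) (reverse-++ t d))
      = reverse r
      , trans (cong reverse ec) (trans (reverse-++ (reverse d) r)
          (cong (reverse r ++_) (reverse-involutive d)))
      , back s r x es , back t r y et

-- Delays

-- Equality of u⁻¹v and u′⁻¹v′ in the free group.
record SameDelay {l : ℕ} (u v u′ v′ : Word l) : Set where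
  constructor mkSameDelay
  field
    e e′ s t : Word l
    u≡  : u  ≡ e  ++ s
    v≡  : v  ≡ e  ++ t
    u′≡ : u′ ≡ e′ ++ s
    v′≡ : v′ ≡ e′ ++ t

module _ {l : ℕ} where

  sd-refl : ∀ (u v : Word l) → SameDelay u v u v
  sd-refl u v = mkSameDelay [] [] u v refl refl refl refl

  sd-sym : ∀ {u v u′ v′ : Word l} → SameDelay u v u′ v′ → SameDelay u′ v′ u v
  sd-sym (mkSameDelay e e′ s t a b c d) = mkSameDelay e′ e s t c d a b

  sd-swap : ∀ {u v u′ v′ : Word l} → SameDelay u v u′ v′ → SameDelay v u v′ u′
  sd-swap (mkSameDelay e e′ s t a b c d) = mkSameDelay e e′ t s b a d c

  sd-trans : ∀ {u v u′ v′ u″ v″ : Word l} →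
    SameDelay u v u′ v′ → SameDelay u′ v′ u″ v″ → SameDelay u v u″ v″
  sd-trans (mkSameDelay e e′ s t refl refl refl refl)
           (mkSameDelay f f′ a b eq₁ eq₂ refl refl)
    with ++-compare e′ f eq₁
  ... | inj₁ (r , refl , refl)
    with refl ← ++-cancelˡ f (r ++ t) b (trans (sym (++-assoc f r t)) eq₂)
    = mkSameDelay e (f′ ++ r) s t refl refl
        (sym (++-assoc f′ r s)) (sym (++-assoc f′ r t))
  ... | inj₂ (r , refl , refl)
    with refl ← ++-cancelˡ e′ t (r ++ b) (trans eq₂ (++-assoc e′ r b))
    = mkSameDelay (e ++ r) f′ a b
        (sym (++-assoc e r a)) (sym (++-assoc e r b)) refl refl

  -- Read as u′u⁻¹ = v′v⁻¹, the relation is transitive in this direction as well.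
  sd-transᶜ : ∀ {u v w u′ v′ w′ : Word l} →
    SameDelay u v u′ v′ → SameDelay v w v′ w′ → SameDelay u w u′ w′
  sd-transᶜ (mkSameDelay e e′ s t refl refl refl refl)
            (mkSameDelay f f′ a b eq₁ refl eq₂ refl)
    with ++-compare e f eq₁
  ... | inj₁ (r , refl , refl)
    with refl ← ++-cancelʳ t e′ (f′ ++ r) (trans eq₂ (sym (++-assoc f′ r t)))
    = mkSameDelay f f′ (r ++ s) b (++-assoc f r s) refl (++-assoc f′ r s) refl
  ... | inj₂ (r , refl , refl)
    with refl ← ++-cancelʳ a (e′ ++ r) f′ (trans (++-assoc e′ r a) eq₂)
    = mkSameDelay e e′ s (r ++ b) refl (++-assoc e r b) refl (++-assoc e′ r b)

  sd-++ʳ : ∀ {u v u′ v′ : Word l} a b → SameDelay u v u′ v′ →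
    SameDelay (u ++ a) (v ++ b) (u′ ++ a) (v′ ++ b)
  sd-++ʳ a b (mkSameDelay e e′ s t refl refl refl refl) =
    mkSameDelay e e′ (s ++ a) (t ++ b)
      (++-assoc e s a) (++-assoc e t b) (++-assoc e′ s a) (++-assoc e′ t b)

  sd-translate : ∀ (a u v : Word l) → SameDelay u v (a ++ u) (a ++ v)
  sd-translate a u v = mkSameDelay [] a u v refl refl refl refl

  sd-++ˡ : ∀ (a a′ : Word l) {u v u′ v′} → SameDelay u v u′ v′ →
    SameDelay (a ++ u) (a ++ v) (a′ ++ u′) (a′ ++ v′)
  sd-++ˡ a a′ {u} {v} {u′} {v′} d =
    sd-trans (sd-sym (sd-translate a u v)) (sd-trans d (sd-translate a′ u′ v′))

  sd-++ˡ⁻ : ∀ (a a′ : Word l) {u v u′ v′} →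
    SameDelay (a ++ u) (a ++ v) (a′ ++ u′) (a′ ++ v′) → SameDelay u v u′ v′
  sd-++ˡ⁻ a a′ {u} {v} {u′} {v′} d =
    sd-trans (sd-translate a u v) (sd-trans d (sd-sym (sd-translate a′ u′ v′)))

  -- Past the maximal common prefix of `u` and `v`, the rests `x` and `y` are the reduced form of
  -- the delay: any witness has `s` = r x and `t` = r y. It remains to test whether u′ = d x and v′
  -- = d y, where `x` leaves one choice of `d`.
  sd? : ∀ (u v u′ v′ : Word l) → Dec (SameDelay u v u′ v′)
  sd? u v u′ v′ with c , x , y , refl , refl , m ← maximalPrefix u v | suffix? x u′
  ... | no ¬s = no λ { (mkSameDelay e e′ s t eu ev eu′ _) →
          let (r , _ , s≡ , _) = m e s t eu ev in
          ¬s (e′ ++ r , trans eu′ (trans (cong (e′ ++_) s≡) (sym (++-assoc e′ r x)))) }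
  ... | yes (d , refl) with v′ ≟ʷ (d ++ y)
  ... | yes refl = yes (mkSameDelay c d x y refl refl refl refl)
  ... | no v′≢ = no λ { (mkSameDelay e e′ s t eu ev eu′ ev′) →
          let (r , _ , s≡ , t≡) = m e s t eu ev
              d≡ = ++-cancelʳ x d (e′ ++ r)
                     (trans eu′ (trans (cong (e′ ++_) s≡) (sym (++-assoc e′ r x))))
          in v′≢ (trans ev′ (trans (cong (e′ ++_) t≡)
                   (trans (sym (++-assoc e′ r y)) (cong (_++ y) (sym d≡))))) }

  dist-++ : ∀ (e s t : Word l) → dist (e ++ s) (e ++ t) ≡ dist s t
  dist-++ []      s t = refl
  dist-++ (a ∷ e) s t = trans (dist-∷ a (e ++ s) (e ++ t)) (dist-++ e s t)

  sd-dist : ∀ {u v u′ v′ : Word l} → SameDelay u v u′ v′ → dist u v ≡ dist u′ v′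
  sd-dist (mkSameDelay e e′ s t refl refl refl refl) =
    trans (dist-++ e s t) (sym (dist-++ e′ s t))

  -- In the free group, eliminating y and y′ by the first equality leaves
  -- g⁻¹cg = g′⁻¹c′g′ and g⁻¹eg = g′⁻¹e′g′, which are multiplied.
  sd-pump : ∀ (a c e g a′ c′ e′ g′ : Word l) {y y′} →
    SameDelay (a ++ g) y (a′ ++ g′) y′ →
    SameDelay (a ++ c ++ g) y (a′ ++ c′ ++ g′) y′ →
    SameDelay (a ++ e ++ g) y (a′ ++ e′ ++ g′) y′ →
    SameDelay (a ++ c ++ e ++ g) y (a′ ++ c′ ++ e′ ++ g′) y′
  sd-pump a c e g a′ c′ e′ g′ h hc he = sd-transᶜ (sd-++ˡ a a′ (sd-transᶜ
      (sd-++ˡ c c′ (relative he)) (relative hc))) h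
    where
    relative : ∀ {x x′} → SameDelay (a ++ x) _ (a′ ++ x′) _ → SameDelay x g x′ g′
    relative hx = sd-++ˡ⁻ a a′ (sd-transᶜ hx (sd-swap h))

module _ {l : ℕ} where

  dist-split : ∀ (u v : Word l) → ∃[ e ] ∃[ s ] ∃[ t ]
    (u ≡ e ++ s × v ≡ e ++ t × length s + length t ≡ dist u v)
  dist-split []      v  = [] , [] , v , refl , refl , refl
  dist-split (a ∷ u) [] = [] , a ∷ u , [] , refl , refl ,
    trans (ℕₚ.+-identityʳ _) (sym (dist-[]ʳ (a ∷ u)))
  dist-split (a ∷ u) (b ∷ v) = go (a Finₚ.≟ b)
    where
    go : Dec (a ≡ b) → ∃[ e ] ∃[ s ] ∃[ t ]
         (a ∷ u ≡ e ++ s × b ∷ v ≡ e ++ t × length s + length t ≡ dist (a ∷ u) (b ∷ v))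
    go (no a≢b) = [] , a ∷ u , b ∷ v , refl , refl , sym (dist-≢ u v a≢b)
    go (yes refl) with e , s , t , refl , refl , eq ← dist-split u v =
      a ∷ e , s , t , refl , refl , trans eq (sym (dist-∷ a (e ++ s) (e ++ t)))

  private
    length-pumped : ∀ (a c b : Word l) m →
      length (a ++ (c ^ m) ++ b) ≡ length a + (m * length c + length b)
    length-pumped a c b m = trans (length-++ a) (cong (length a +_)
      (trans (length-++ (c ^ m)) (cong (_+ length b) (length-^ c m))))

    BoundedPumping : (a c b a′ c′ b′ : Word l) → ℕ → Set
    BoundedPumping a c b a′ c′ b′ B =
      ∀ m → dist (a ++ (c ^ m) ++ b) (a′ ++ (c′ ^ m) ++ b′) ≤ B

    flip-pumping : ∀ {a c b a′ c′ b′ B} →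
      BoundedPumping a c b a′ c′ b′ B → BoundedPumping a′ c′ b′ a c b B
    flip-pumping {a} {c} {b} {B = B} h m = subst (_≤ B) (dist-sym (a ++ (c ^ m) ++ b) _) (h m)

    -- The distance is at least the difference of the lengths. If `c` were longer, this difference
    -- would grow with every iteration, and `K` + 1 iterations outgrow the constant part `K`.
    pumped-length-≤ : ∀ {a c b a′ c′ b′ B} →
      BoundedPumping a c b a′ c′ b′ B → length c ≤ length c′
    pumped-length-≤ {a} {c} {b} {a′} {c′} {b′} {B} h =
      ℕₚ.≮⇒≥ λ c′<c → ℕₚ.<-irrefl refl (too-long c′<c)
      where
      open ℕₚ.≤-Reasoning
      K = length a′ + length b′ + B
      m = suc K
      too-long : length c′ < length c → m * length c′ + K < m * length c′ + K
      too-long c′<c = begin-strict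
        m * length c′ + K          <⟨ ℕₚ.+-monoʳ-< (m * length c′) (ℕₚ.n<1+n K) ⟩
        m * length c′ + m          ≡⟨ ℕₚ.+-comm (m * length c′) m ⟩
        m + m * length c′          ≡⟨ ℕₚ.*-suc m (length c′) ⟨
        m * suc (length c′)        ≤⟨ ℕₚ.*-monoʳ-≤ m c′<c ⟩
        m * length c               ≤⟨ ℕₚ.m≤m+n _ (length b) ⟩
        m * length c + length b    ≤⟨ ℕₚ.m≤n+m _ (length a) ⟩
        length a + (m * length c + length b)  ≡⟨ length-pumped a c b m ⟨
        length (a ++ (c ^ m) ++ b)            ≤⟨ length-≤ (a′ ++ (c′ ^ m) ++ b′) _ ⟩
        length (a′ ++ (c′ ^ m) ++ b′) + dist (a′ ++ (c′ ^ m) ++ b′) (a ++ (c ^ m) ++ b)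
          ≤⟨ ℕₚ.+-monoʳ-≤ (length (a′ ++ (c′ ^ m) ++ b′)) (flip-pumping {a} {c} {b} {a′} h m) ⟩
        length (a′ ++ (c′ ^ m) ++ b′) + B  ≡⟨ cong (_+ B) (length-pumped a′ c′ b′ m) ⟩
        length a′ + (m * length c′ + length b′) + B
          ≡⟨ cong (λ x → length a′ + x + B) (ℕₚ.+-comm (m * length c′) _) ⟩
        length a′ + (length b′ + m * length c′) + B
          ≡⟨ cong (_+ B) (ℕₚ.+-assoc (length a′) (length b′) _) ⟨
        length a′ + length b′ + m * length c′ + B
          ≡⟨ cong (_+ B) (ℕₚ.+-comm (length a′ + length b′) _) ⟩
        m * length c′ + (length a′ + length b′) + B
          ≡⟨ ℕₚ.+-assoc (m * length c′) _ B ⟩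
        m * length c′ + K          ∎

    ≤-*ʳ : ∀ n {m} → 1 ≤ m → n ≤ n * m
    ≤-*ʳ n {suc m} _ = ℕₚ.m≤m*n n (suc m)

    -- For many iterations the common prefix of the two words covers a′c′, so a′ = aδ. Then cδ and
    -- δc′ are prefixes of the same word and of equal length, hence cδ = δc′, and both delays are δ.
    twin-≤ : ∀ {a c b a′ c′ b′ B} → BoundedPumping a c b a′ c′ b′ B →
      length c ≡ length c′ → 1 ≤ length c → length a ≤ length a′ →
      SameDelay a a′ (a ++ c) (a′ ++ c′)
    twin-≤ {a} {c} {b} {a′} {c′} {b′} {B} h |c|≡ 1≤|c| a≤a′
      with e , s , t , u≡ , v≡ , st≡ ← dist-split (a ++ (c ^ suc (length a′ + B)) ++ b)
                                                  (a′ ++ (c′ ^ suc (length a′ + B)) ++ b′)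
      = go (⊑⇒++ (⊑-length (⊑-++ a _) a′⊑u a≤a′))
      where
      open ℕₚ.≤-Reasoning
      -- As `c` is nonempty, `n` copies make up for `a′` and for at most `B` letters beyond the
      -- common prefix. One further copy makes room for `c′`, which is as long as `c`.
      n = length a′ + B
      |e|≥ : length a′ + length c ≤ length e
      |e|≥ = ℕₚ.+-cancelʳ-≤ (length s) _ _ (begin
        length a′ + length c + length s    ≡⟨ cong (_+ length s) (ℕₚ.+-comm (length a′) _) ⟩
        length c + length a′ + length s    ≡⟨ ℕₚ.+-assoc (length c) _ _ ⟩
        length c + (length a′ + length s)
          ≤⟨ ℕₚ.+-monoʳ-≤ (length c) (ℕₚ.+-monoʳ-≤ (length a′)
               (ℕₚ.≤-trans (ℕₚ.m≤m+n _ (length t))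
                 (ℕₚ.≤-trans (ℕₚ.≤-reflexive st≡) (h (suc n))))) ⟩
        length c + n                       ≤⟨ ℕₚ.+-monoʳ-≤ (length c) (≤-*ʳ n 1≤|c|) ⟩
        suc n * length c                   ≤⟨ ℕₚ.m≤m+n _ (length b) ⟩
        suc n * length c + length b        ≤⟨ ℕₚ.m≤n+m _ (length a) ⟩
        length a + (suc n * length c + length b)  ≡⟨ length-pumped a c b (suc n) ⟨
        length (a ++ (c ^ suc n) ++ b)     ≡⟨ cong length u≡ ⟩
        length (e ++ s)                    ≡⟨ length-++ e ⟩
        length e + length s                ∎)
      e⊑u : e ⊑ (a ++ (c ^ suc n) ++ b)
      e⊑u = ++⇒⊑ u≡
      a′c′⊑v : (a′ ++ c′) ⊑ (a′ ++ (c′ ^ suc n) ++ b′)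
      a′c′⊑v = ⊑-++⁺ a′ (⊑-trans (⊑-++ c′ (c′ ^ n)) (⊑-++ (c′ ^ suc n) b′))
      a′c′⊑u : (a′ ++ c′) ⊑ (a ++ (c ^ suc n) ++ b)
      a′c′⊑u = ⊑-trans (⊑-length a′c′⊑v (++⇒⊑ v≡)
        (subst (_≤ length e) (sym (trans (length-++ a′) (cong (length a′ +_) (sym |c|≡)))) |e|≥)) e⊑u
      a′⊑u : a′ ⊑ (a ++ (c ^ suc n) ++ b)
      a′⊑u = ⊑-trans (⊑-++ a′ c′) a′c′⊑u
      go : ∃[ δ ] a′ ≡ a ++ δ → SameDelay a a′ (a ++ c) (a′ ++ c′)
      go (δ , refl) = mkSameDelay a (a ++ c) [] δ (sym (++-identityʳ a)) refl
        (sym (++-identityʳ (a ++ c)))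
        (trans (++-assoc a δ c′) (trans (cong (a ++_) (sym cδ≡δc′)) (sym (++-assoc a c δ))))
        where
        δc′⊑ : (δ ++ c′) ⊑ ((c ^ suc n) ++ b)
        δc′⊑ = ⊑-++⁻ a (subst (_⊑ (a ++ (c ^ suc n) ++ b)) (++-assoc a δ c′) a′c′⊑u)
        δ⊑ : δ ⊑ (c ^ n)
        δ⊑ = ⊑-length (⊑-trans (⊑-++ δ c′) δc′⊑)
          (++⇒⊑ (trans (cong (_++ b) (^-suc c n)) (++-assoc (c ^ n) c b)))
          (begin
            length δ             ≤⟨ ℕₚ.m≤n+m _ (length a) ⟩
            length a + length δ  ≡⟨ length-++ a ⟨
            length (a ++ δ)      ≤⟨ ℕₚ.m≤m+n _ B ⟩
            n                    ≤⟨ ≤-*ʳ n 1≤|c| ⟩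
            n * length c         ≡⟨ length-^ c n ⟨
            length (c ^ n)       ∎)
        cδ≡δc′ : c ++ δ ≡ δ ++ c′
        cδ≡δc′ = ⊑-length-≡ (⊑-trans (⊑-++⁺ c δ⊑) (⊑-++ (c ^ suc n) b)) δc′⊑
          (trans (length-++ c) (trans (ℕₚ.+-comm (length c) _)
            (trans (cong (length δ +_) |c|≡) (sym (length-++ δ)))))

  -- Pumping a loop must preserve the delay: otherwise either the lengths or the
  -- infinite words a c^ω and a′ c′^ω drift apart.
  twin : ∀ {a c b a′ c′ b′ B} →
    (∀ m → dist (a ++ (c ^ m) ++ b) (a′ ++ (c′ ^ m) ++ b′) ≤ B) →
    SameDelay a a′ (a ++ c) (a′ ++ c′)
  twin {a} {c} {b} {a′} {c′} {b′} {B} h = go c c′ refl refl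
    where
    h′ : BoundedPumping a′ c′ b′ a c b B
    h′ = flip-pumping {a} {c} {b} {a′} h
    |c|≡ : length c ≡ length c′
    |c|≡ = ℕₚ.≤-antisym (pumped-length-≤ {a} {c} {b} {a′} h) (pumped-length-≤ {a′} {c′} {b′} {a} h′)
    go : ∀ x y → x ≡ c → y ≡ c′ → SameDelay a a′ (a ++ c) (a′ ++ c′)
    go [] [] refl refl =
      subst₂ (SameDelay a a′) (sym (++-identityʳ a)) (sym (++-identityʳ a′)) (sd-refl a a′)
    go [] (_ ∷ _) refl refl with () ← |c|≡
    go (x ∷ xs) _ refl refl with ℕₚ.≤-total (length a) (length a′)
    ... | inj₁ a≤a′ = twin-≤ {b = b} h |c|≡ (s≤s z≤n) a≤a′
    ... | inj₂ a′≤a = sd-swap (twin-≤ {b = b′} h′ (sym |c|≡)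
                        (subst (1 ≤_) |c|≡ (s≤s z≤n)) a′≤a)

-- Longest common prefixes

module _ {l : ℕ} where

  Common : (Word l → Set) → Word l → Set
  Common L z = ∀ x → L x → z ⊑ x

  lcp-common : ∀ {L : Word l → Set} {p y} → IsLCP L p → L y → Common L p
  lcp-common (inj₁ (_ , c , _)) _  = c
  lcp-common (inj₂ (¬L , _))    Ly = ⊥-elim (¬L (_ , Ly))

  lcp-greatest : ∀ {L : Word l → Set} {p y} → IsLCP L p → L y → ∀ z → Common L z → z ⊑ p
  lcp-greatest (inj₁ (_ , _ , g)) _  = g
  lcp-greatest (inj₂ (¬L , _))    Ly = ⊥-elim (¬L (_ , Ly))

  lcp-unique : ∀ {L : Word l → Set} {p q y} → IsLCP L p → IsLCP L q → L y → p ≡ q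
  lcp-unique P Q Ly = ⊑-antisym (lcp-greatest Q Ly _ (lcp-common P Ly))
                                (lcp-greatest P Ly _ (lcp-common Q Ly))

  lcp-cong : ∀ {L L′ : Word l → Set} {p} → (∀ y → L y ⇔ L′ y) → IsLCP L p → IsLCP L′ p
  lcp-cong e (inj₁ ((y , Ly) , c , g)) =
    inj₁ ((y , Equivalence.to (e y) Ly) , (λ x L′x → c x (Equivalence.from (e x) L′x)) ,
          λ z c′ → g z λ x Lx → c′ x (Equivalence.to (e x) Lx))
  lcp-cong e (inj₂ (¬L , p≡)) = inj₂ ((λ (y , L′y) → ¬L (y , Equivalence.from (e y) L′y)) , p≡)

  -- Used with M the identity, for decidable Common L, and with M = ¬¬.
  lcp-search : {M : Set → Set} (pure : ∀ {A} → A → M A) (bind : ∀ {A B} → M A → (A → M B) → M B)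
    {L : Word l → Set} → (∀ z → M (Dec (Common L z))) → ∀ {y} → L y → M (∃ (IsLCP L))
  lcp-search {M} pure bind {L} dec {y} Ly = go [] y refl (λ _ _ → [])
    where
    go : ∀ e s → y ≡ e ++ s → Common L e → M (∃ (IsLCP L))
    go e [] y≡ c = pure (e , inj₁ ((y , Ly) , c ,
      λ z c′ → subst (z ⊑_) (trans y≡ (++-identityʳ e)) (c′ y Ly)))
    -- Every common prefix is a prefix of the known element `y`, so `e` grows along `y` until the
    -- first letter that fails.
    go e (a ∷ s) y≡ c = bind (dec (e ++ [ a ])) λ
      { (yes c⁺) → go (e ++ [ a ]) s (trans y≡ (sym (++-assoc e [ a ] s))) c⁺
      ; (no ¬c⁺) → pure (e , inj₁ ((y , Ly) , c , greatest ¬c⁺)) }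
      where
      ea⊑y : (e ++ [ a ]) ⊑ y
      ea⊑y = ++⇒⊑ (trans y≡ (sym (++-assoc e [ a ] s)))
      greatest : ¬ Common L (e ++ [ a ]) → ∀ z → Common L z → z ⊑ e
      greatest ¬c⁺ z c′ with length z ℕₚ.≤? length e
      ... | yes h = ⊑-length (c′ y Ly) (c y Ly) h
      ... | no ¬h = ⊥-elim (¬c⁺ λ x Lx → ⊑-trans (⊑-length ea⊑y (c′ y Ly)
                      (subst (_≤ length z) (sym (trans (length-++ e) (ℕₚ.+-comm (length e) 1)))
                        (ℕₚ.≰⇒> ¬h))) (c′ x Lx))

  -- Factor y₀ = E S and y₀′ = E′ S with S their maximal common suffix.  Equality of
  -- delays makes E a common prefix of L and E′ one of L′, and E, E′ are then extended
  -- by the same words.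
  opaque
    lcp-transfer : ∀ {L L′ : Word l → Set} {y₀ y₀′ p r} → L y₀ → L′ y₀′ →
      (∀ {y} → L y → ∃[ y′ ] (L′ y′ × SameDelay y₀ y y₀′ y′)) →
      (∀ {y′} → L′ y′ → ∃[ y ] (L y × SameDelay y₀ y y₀′ y′)) →
      IsLCP L p → y₀ ≡ p ++ r → ∃[ p′ ] (IsLCP L′ p′ × y₀′ ≡ p′ ++ r)
    lcp-transfer {L} {L′} {y₀} {y₀′} {p} {r} Ly₀ L′y₀′ to from P y₀≡
      with E , E′ , S , e₀ , e₀′ , max ← maximalSuffix y₀ y₀′ = result
      where
      Shifted : Word l → Word l → Set
      Shifted y y′ = ∃[ t ] (y ≡ E ++ t × y′ ≡ E′ ++ t)
      shifted : ∀ {y y′} → SameDelay y₀ y y₀′ y′ → Shifted y y′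
      shifted (mkSameDelay e e′ s t h₀ h h₀′ h′)
        with r , _ , refl , refl ← max s e e′ h₀ h₀′
        = r ++ t , trans h (++-assoc E r t) , trans h′ (++-assoc E′ r t)
      E-common : Common L E
      E-common y Ly with _ , _ , d ← to Ly with _ , y≡ , _ ← shifted d = ++⇒⊑ y≡
      E′-common : Common L′ E′
      E′-common y′ L′y′ with _ , _ , d ← from L′y′ with _ , _ , y′≡ ← shifted d = ++⇒⊑ y′≡
      shift : ∀ q → Common L (E ++ q) → Common L′ (E′ ++ q)
      shift q c y′ L′y′ with y , Ly , d ← from L′y′ with t , refl , refl ← shifted d =
        ⊑-++⁺ E′ (⊑-++⁻ E (c y Ly))
      unshift : ∀ q → Common L′ (E′ ++ q) → Common L (E ++ q)
      unshift q c y Ly with y′ , L′y′ , d ← to Ly with t , refl , refl ← shifted d =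
        ⊑-++⁺ E (⊑-++⁻ E′ (c y′ L′y′))
      result : ∃[ p′ ] (IsLCP L′ p′ × y₀′ ≡ p′ ++ r)
      result with q , refl ← ⊑⇒++ (lcp-greatest P Ly₀ E E-common) =
        E′ ++ q , inj₁ ((y₀′ , L′y₀′) , shift q (lcp-common P Ly₀) , greatest) ,
        trans e₀′ (trans (cong (E′ ++_) S≡) (sym (++-assoc E′ q r)))
        where
        S≡ : S ≡ q ++ r
        S≡ = ++-cancelˡ E S (q ++ r) (trans (sym e₀) (trans y₀≡ (++-assoc E q r)))
        greatest : ∀ z → Common L′ z → z ⊑ (E′ ++ q)
        greatest z c with ⊑-compare (c y₀′ L′y₀′) (E′-common y₀′ L′y₀′)
        ... | inj₁ z⊑E′ = ⊑-trans z⊑E′ (⊑-++ E′ q)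
        ... | inj₂ E′⊑z with q′ , refl ← ⊑⇒++ E′⊑z =
          ⊑-++⁺ E′ (⊑-++⁻ E (lcp-greatest P Ly₀ (E ++ q′) (unshift q′ c)))

-- The canonical automata through congruences on words

module ⇔ = IsEquivalence (⇔-isEquivalence {0ℓ})

module Canonical {k l : ℕ} (f : Transduction k l) where
  open Transduction f
  module Close = IsEquivalence (Close-isEquivalence f)
  module SimL = IsEquivalence (SimL-isEquivalence f)

  close-++ˡ : ∀ w {u v} → Close f u v → Close f (w ++ u) (w ++ v)
  close-++ˡ w {u} {v} (d , B , b) =
      (λ x → subst₂ (λ y z → Dom y ⇔ Dom z) (++-assoc x w u) (++-assoc x w v) (d (x ++ w)))
    , B , λ x y z gy gz → b (x ++ w) y z (subst (λ t → graph t y) (sym (++-assoc x w u)) gy)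
                                         (subst (λ t → graph t z) (sym (++-assoc x w v)) gz)

  hat-cong : ∀ {w w′ u p} → Close f w w′ → HatF f w u p → HatF f w′ u p
  hat-cong c = lcp-cong λ y → mk⇔ (λ (v , d , g) → v , Close.trans d c , g)
                                  (λ (v , d , g) → v , Close.trans d (Close.sym c) , g)

  hat-unique : ∀ {w u p q} → HatF f w u p → HatF f w u q → Dom (u ++ w) → p ≡ q
  hat-unique {w} P Q (_ , g) = lcp-unique P Q (w , Close.refl , g)

  -- ∼_L without reference to longest common prefixes; in particular it is evidently
  -- a right congruence.
  SimD : Word k → Word k → Set
  SimD u v = (∀ w → Dom (u ++ w) ⇔ Dom (v ++ w)) ×
    (∀ {w₁ w₂} → Close f w₁ w₂ → ∀ {x₁ x₂ y₁ y₂} →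
     graph (u ++ w₁) x₁ → graph (u ++ w₂) x₂ → graph (v ++ w₁) y₁ → graph (v ++ w₂) y₂ →
     SameDelay x₁ x₂ y₁ y₂)

  simD-refl : ∀ {u} → SimD u u
  simD-refl = (λ _ → ⇔.refl) , λ where
    _ {x₁} {x₂} gx₁ gx₂ gy₁ gy₂ → subst₂ (SameDelay x₁ x₂)
      (functional gx₁ gy₁) (functional gx₂ gy₂) (sd-refl x₁ x₂)

  simD-sym : ∀ {u v} → SimD u v → SimD v u
  simD-sym (d , s) = (λ w → ⇔.sym (d w)) , λ c gx₁ gx₂ gy₁ gy₂ → sd-sym (s c gy₁ gy₂ gx₁ gx₂)

  simD-trans : ∀ {u v w} → SimD u v → SimD v w → SimD u w
  simD-trans (d , s) (d′ , s′) = (λ w → ⇔.trans (d w) (d′ w)) , λ {w₁} {w₂} c gx₁ gx₂ gy₁ gy₂ →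
    let (_ , gz₁) = to (d w₁) (_ , gx₁) ; (_ , gz₂) = to (d w₂) (_ , gx₂) in
    sd-trans (s c gx₁ gx₂ gz₁ gz₂) (s′ c gz₁ gz₂ gy₁ gy₂)

  simD-++ʳ : ∀ {u v} x → SimD u v → SimD (u ++ x) (v ++ x)
  simD-++ʳ {u} {v} x (d , s) =
      (λ w → subst₂ (λ y z → Dom y ⇔ Dom z) (sym (++-assoc u x w)) (sym (++-assoc v x w)) (d (x ++ w)))
    , λ {w₁} {w₂} c gx₁ gx₂ gy₁ gy₂ →
        s (close-++ˡ x c) (shift u w₁ gx₁) (shift u w₂ gx₂) (shift v w₁ gy₁) (shift v w₂ gy₂)
    where
    shift : ∀ u w {y} → graph ((u ++ x) ++ w) y → graph (u ++ x ++ w) y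
    shift u w {y} = subst (λ t → graph t y) (++-assoc u x w)

  simD-residual : ∀ {u v} → SimD u v → ∀ {w r} → Residual f u w r → Residual f v w r
  simD-residual {u} {v} (d , s) {w} (p , P , g)
    with y₀ , g₀ ← to (d w) (_ , g)
    with p′ , P′ , refl ← lcp-transfer
           (w , Close.refl , g) (w , Close.refl , g₀)
           (λ { (x , c , gx) → let (y , gy) = to (d x) (_ , gx) in
                  y , (x , c , gy) , s (Close.sym c) g gx g₀ gy })
           (λ { (x , c , gy) → let (y , gx) = from (d x) (_ , gy) in
                  y , (x , c , gx) , s (Close.sym c) g gx g₀ gy })
           P refl
    = p′ , P′ , g₀

  simD⇒simL : ∀ {u v} → SimD u v → SimL f u v
  simD⇒simL s w = proj₁ s w , λ r → mk⇔ (simD-residual s) (simD-residual (simD-sym s))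

  -- The longest common prefixes need not exist constructively, but they exist up to
  -- double negation, and SameDelay is decidable.
  simL⇒simD : ∀ {u v} → SimL f u v → SimD u v
  simL⇒simD {u} {v} s = (λ w → proj₁ (s w)) , λ {w₁} {w₂} c {x₁} {x₂} {y₁} {y₂} gx₁ gx₂ gy₁ gy₂ →
    decidable-stable (sd? x₁ x₂ y₁ y₂) λ ¬sd →
      lcp-search {M = λ A → ¬ ¬ A} (λ a ¬a → ¬a a) (λ m h ¬b → m λ a → h a ¬b)
        (λ _ → ¬¬-excluded-middle) (w₁ , Close.refl , gx₁)
        λ (p , P) → ¬sd (same-delay c gx₁ gx₂ gy₁ gy₂ P)
    where
    -- The longest common prefix belongs to the class, so one prefix serves both `w₁` and `w₂`.
    -- After it come the residuals `r₁` and `r₂`, which are the same for `u` and for `v`.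
    same-delay : ∀ {w₁ w₂ p x₁ x₂ y₁ y₂} → Close f w₁ w₂ →
      graph (u ++ w₁) x₁ → graph (u ++ w₂) x₂ → graph (v ++ w₁) y₁ → graph (v ++ w₂) y₂ →
      HatF f w₁ u p → SameDelay x₁ x₂ y₁ y₂
    same-delay {w₁} {w₂} {p} c gx₁ gx₂ gy₁ gy₂ P
      with r₁ , refl ← ⊑⇒++ (lcp-common P (w₁ , Close.refl , gx₁) _ (w₁ , Close.refl , gx₁))
         | r₂ , refl ← ⊑⇒++ (lcp-common P (w₁ , Close.refl , gx₁) _ (w₂ , Close.sym c , gx₂))
      with p₁ , P₁ , g₁ ← to (proj₂ (s w₁) r₁) (p , P , gx₁)
         | p₂ , P₂ , g₂ ← to (proj₂ (s w₂) r₂) (p , hat-cong c P , gx₂)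
      with refl ← functional gy₁ g₁ | refl ← functional gy₂ g₂
         | refl ← hat-unique P₁ (hat-cong (Close.sym c) P₂) (_ , g₁)
      = mkSameDelay p p₁ r₁ r₂ refl refl refl refl

  simL-++ʳ : ∀ {u v} x → SimL f u v → SimL f (u ++ x) (v ++ x)
  simL-++ʳ x s = simD⇒simL (simD-++ʳ x (simL⇒simD s))

  private
    module L = Automaton (canonicalLeft f)
    module R = Automaton (canonicalRight f)

  right-run : ∀ {p q} u → R.Run p u q ⇔ Close f p (u ++ q)
  right-run u = mk⇔ forth (back u)
    where
    forth : ∀ {p u q} → R.Run p u q → Close f p (u ++ q)
    forth (R.done c) = c
    forth (R.step {σ = σ} (w , c , d) r) =
      Close.trans c (close-++ˡ [ σ ] (Close.trans (Close.sym d) (forth r)))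
    back : ∀ {p q} u → Close f p (u ++ q) → R.Run p u q
    back []      c = R.done c
    back (σ ∷ u) c = R.step (_ , c , Close.refl) (back u Close.refl)

  left-run : ∀ {p q} u → L.Run p u q ⇔ SimL f (p ++ u) q
  left-run u = mk⇔ forth (back u)
    where
    forth : ∀ {p u q} → L.Run p u q → SimL f (p ++ u) q
    forth {p} (L.done s) = subst (λ x → SimL f x _) (sym (++-identityʳ p)) s
    forth {p} (L.step {σ = σ} {u = u} (v , s , t) r) = SimL.trans
      (subst (λ x → SimL f x _) (++-assoc p [ σ ] u)
        (simL-++ʳ u (SimL.trans (simL-++ʳ [ σ ] s) (SimL.sym t)))) (forth r)
    back : ∀ {p q} u → SimL f (p ++ u) q → L.Run p u q
    back {p} []      s = L.done (subst (λ x → SimL f x _) (++-identityʳ p) s)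
    back {p} (σ ∷ u) s = L.step (p , SimL.refl , SimL.refl)
      (back u (subst (λ x → SimL f x _) (sym (++-assoc p [ σ ] u)) s))

  right-aperiodic : AperiodicAutomaton (canonicalRight f) ⇔
    (∃[ n ] (∀ w q → Close f ((w ^ n) ++ q) ((w ^ suc n) ++ q)))
  right-aperiodic = mk⇔
    (λ (n , h) → n , λ w q → to (right-run (w ^ suc n))
      (to (h w ((w ^ n) ++ q) q) (from (right-run (w ^ n)) Close.refl)))
    (λ (n , h) → n , λ w p q → mk⇔
      (λ r → from (right-run (w ^ suc n)) (Close.trans (to (right-run (w ^ n)) r) (h w q)))
      (λ r → from (right-run (w ^ n)) (Close.trans (to (right-run (w ^ suc n)) r) (Close.sym (h w q)))))

  left-aperiodic : AperiodicAutomaton (canonicalLeft f) ⇔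
    (∃[ n ] (∀ w p → SimD (p ++ (w ^ n)) (p ++ (w ^ suc n))))
  left-aperiodic = mk⇔
    (λ (n , h) → n , λ w p → simD-sym (simL⇒simD (to (left-run (w ^ suc n))
      (to (h w p (p ++ (w ^ n))) (from (left-run (w ^ n)) SimL.refl)))))
    (λ (n , h) → n , λ w p q → mk⇔
      (λ r → from (left-run (w ^ suc n))
        (SimL.trans (SimL.sym (simD⇒simL (h w p))) (to (left-run (w ^ n)) r)))
      (λ r → from (left-run (w ^ n))
        (SimL.trans (simD⇒simL (h w p)) (to (left-run (w ^ suc n)) r))))

-- Finiteness

Listable : {A : Set} → (A → Set) → Set
Listable {A} R = Σ (List A) λ xs → ∀ {a} → a ∈ xs ⇔ R a

module _ {A : Set} {R : A → Set} where

  listable-⇔ : {S : A → Set} → (∀ a → R a ⇔ S a) → Listable R → Listable S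
  listable-⇔ e (xs , m) = xs , λ {a} → ⇔.trans m (e a)

  listable-filter : {P : A → Set} → (∀ a → Dec (P a)) → Listable R → Listable (λ a → R a × P a)
  listable-filter P? (xs , m) = filter P? xs , mk⇔
    (λ a∈ → let (a∈xs , Pa) = ∈-filter⁻ P? {xs = xs} a∈ in to m a∈xs , Pa)
    (λ (Ra , Pa) → ∈-filter⁺ P? (from m Ra) Pa)

  listable-Σ : {B : Set} {S : A → B → Set} → Listable R → (∀ a → Listable (S a)) →
    Listable (λ (ab : A × B) → R (proj₁ ab) × S (proj₁ ab) (proj₂ ab))
  listable-Σ {B} {S} (xs , m) ss = concatMap row xs , mk⇔ forth back
    where
    row : A → List (A × B)
    row a = map (a ,_) (proj₁ (ss a))
    forth : ∀ {ab} → ab ∈ concatMap row xs → R (proj₁ ab) × S (proj₁ ab) (proj₂ ab)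
    forth ab∈
      with a , a∈ , b∈ ← find (∈-concatMap⁻ row {xs} ab∈)
      with b , b∈ , refl ← ∈-map⁻ (a ,_) b∈
      = to m a∈ , to (proj₂ (ss a)) b∈
    back : ∀ {ab} → R (proj₁ ab) × S (proj₁ ab) (proj₂ ab) → ab ∈ concatMap row xs
    back {a , b} (Ra , Sab) = ∈-concatMap⁺ row (lose (from m Ra)
      (∈-map⁺ (a ,_) (from (proj₂ (ss a)) Sab)))

  listable-image : {B : Set} (g : A → B) → Listable R → Listable (λ b → ∃[ a ] (R a × b ≡ g a))
  listable-image g (xs , m) = map g xs , mk⇔
    (λ b∈ → let (a , a∈ , eq) = ∈-map⁻ g b∈ in a , to m a∈ , eq)
    (λ { (a , Ra , refl) → ∈-map⁺ g (from m Ra) })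

  listable-∀? : {P : A → Set} → Listable R → (∀ a → R a → Dec (P a)) → Dec (∀ {a} → R a → P a)
  listable-∀? {P} (xs , m) P? = map′ (λ h Ra → All.lookup h (from m Ra))
    (λ h → All.tabulate λ a∈ → h (to m a∈)) (all xs λ a a∈ → P? a (to m a∈))
    where
    all : ∀ ys → (∀ a → a ∈ ys → Dec (P a)) → Dec (All.All P ys)
    all []       _  = yes All.[]
    all (y ∷ ys) d with d y (here refl) | all ys (λ a a∈ → d a (there a∈))
    ... | yes p | yes ps = yes (p All.∷ ps)
    ... | no ¬p | _      = no λ { (p All.∷ _) → ¬p p }
    ... | _     | no ¬ps = no λ { (_ All.∷ ps) → ¬ps ps }

  listable-∃? : Listable R → Dec (∃ R)
  listable-∃? ([]     , m) = no λ (_ , Ra) → case from m Ra of λ ()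
  listable-∃? (x ∷ xs , m) = yes (x , to m (here refl))

  opaque
    listable-bounded : Listable R → (h : A → ℕ) → ∃[ B ] (∀ {a} → R a → h a ≤ B)
    listable-bounded (xs , m) h = let (B , b) = bound xs in B , λ Ra → b (from m Ra)
      where
      bound : ∀ ys → ∃[ B ] (∀ {a} → a ∈ ys → h a ≤ B)
      bound []       = 0 , λ ()
      bound (y ∷ ys) with B , b ← bound ys = h y ⊔ B , λ where
        (here refl) → ℕₚ.m≤m⊔n (h y) B
        (there a∈)  → ℕₚ.≤-trans (b a∈) (ℕₚ.m≤n⊔m (h y) B)

listable-fin : ∀ {n} → Listable {Fin n} (λ _ → ⊤)
listable-fin {n} = allFin n , mk⇔ (λ _ → tt) (λ _ → ∈-allFin _)

listable-singleton : {A : Set} (a : A) → Listable (_≡ a)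
listable-singleton a = a ∷ [] , mk⇔ (λ { (here eq) → eq ; (there ()) }) here

listable-just : {A : Set} (m : Maybe A) → Listable (λ a → m ≡ just a)
listable-just (just a) = listable-⇔ (λ _ → mk⇔ (λ { refl → refl }) (λ { refl → refl }))
                                    (listable-singleton a)
listable-just nothing  = [] , mk⇔ (λ ()) (λ ())

listable-words : ∀ {k} n → Listable {Word k} (λ w → length w ≤ n)
listable-words zero    = listable-⇔
  (λ { [] → mk⇔ (λ _ → z≤n) (λ _ → refl) ; (_ ∷ _) → mk⇔ (λ ()) (λ ()) })
  (listable-singleton [])
listable-words {k} (suc n) with ws , m ← listable-words {k} n =
  [] ∷ cartesianProductWith _∷_ (allFin k) ws , mk⇔ forth back
  where
  forth : ∀ {w} → w ∈ [] ∷ cartesianProductWith _∷_ (allFin k) ws → length w ≤ suc n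
  forth (here refl) = z≤n
  forth (there w∈)
    with _ , _ , _ , v∈ , refl ← ∈-cartesianProductWith⁻ _∷_ (allFin k) ws w∈ = s≤s (to m v∈)
  back : ∀ {w} → length w ≤ suc n → w ∈ [] ∷ cartesianProductWith _∷_ (allFin k) ws
  back {[]}    _       = here refl
  back {a ∷ w} (s≤s h) = there (∈-cartesianProductWith⁺ _∷_ (∈-allFin a) (from m h))

-- A relation coarser than the kernel of a map to a finite set.
FiniteIndex : {X : Set} → (X → X → Set) → Set
FiniteIndex {X} R = ∃[ N ] Σ (X → Fin N) λ colour → ∀ {x y} → colour x ≡ colour y → R x y

index-size : ∀ {X : Set} {R : X → X → Set} → FiniteIndex R → ℕ
index-size = proj₁

fi-fin : ∀ {n} → FiniteIndex {Fin n} _≡_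
fi-fin {n} = n , (λ i → i) , λ eq → eq

fi-on : ∀ {X Y : Set} {R : X → X → Set} (g : Y → X) → FiniteIndex R → FiniteIndex (λ x y → R (g x) (g y))
fi-on g (N , c , h) = N , (λ y → c (g y)) , h

fi-× : ∀ {X : Set} {R S : X → X → Set} → FiniteIndex R → FiniteIndex S →
  FiniteIndex (λ x y → R x y × S x y)
fi-× (M , c , h) (N , d , i) = M * N , (λ x → combine (c x) (d x)) , λ eq →
  let (eq₁ , eq₂) = Finₚ.combine-injective _ _ _ _ eq in h eq₁ , i eq₂

fi-dec : ∀ {X : Set} {P : X → Set} → (∀ x → Dec (P x)) → FiniteIndex (λ x y → P x ⇔ P y)
fi-dec {X} {P} P? = 2 , (λ x → colour (P? x)) , λ {x} {y} → same (P? x) (P? y)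
  where
  colour : ∀ {A : Set} → Dec A → Fin 2
  colour (yes _) = fzero
  colour (no _)  = fsuc fzero
  same : ∀ {A B : Set} (a? : Dec A) (b? : Dec B) → colour a? ≡ colour b? → A ⇔ B
  same (yes a) (yes b) _ = mk⇔ (λ _ → b) (λ _ → a)
  same (no ¬a) (no ¬b) _ = mk⇔ (λ a → ⊥-elim (¬a a)) (λ b → ⊥-elim (¬b b))

-- The colour of `x` is the vector of truth values of `Φ z x`, for `z` in the list.
fi-∀ : ∀ {X Z : Set} {R : Z → Set} {Φ : Z → X → Set} → Listable R → (∀ z x → Dec (Φ z x)) →
  FiniteIndex (λ x y → ∀ {z} → R z → Φ z x ⇔ Φ z y)
fi-∀ {X} {Z} {R} {Φ} (zs , m) Φ? = let (N , c , h) = go zs in N , c , λ eq Rz → h eq (from m Rz)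
  where
  go : ∀ zs → FiniteIndex (λ x y → ∀ {z} → z ∈ zs → Φ z x ⇔ Φ z y)
  go []       = 1 , (λ _ → fzero) , λ _ ()
  go (z ∷ zs) with N , c , h ← fi-× (fi-dec (Φ? z)) (go zs) = N , c , λ where
    eq (here refl) → proj₁ (h eq)
    eq (there z∈)  → proj₂ (h eq) z∈

pigeonhole : ∀ {X : Set} {R : X → X → Set} (fi : FiniteIndex R) (x : ℕ → X) →
  ∃[ i ] ∃[ j ] (i < j × j ≤ index-size fi × R (x i) (x j))
pigeonhole (N , c , h) x with i , j , i<j , eq ← Finₚ.pigeonhole (ℕₚ.n<1+n N) (λ i → c (x (toℕ i)))
  = toℕ i , toℕ j , i<j , Finₚ.toℕ≤pred[n] j , h eq

-- Two pairs of equally coloured positions in distinct blocks, again of equal colours.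
pigeonhole₃ : ∀ {X : Set} {R : X → X → Set} (fi : FiniteIndex R) (x : ℕ → X) →
  ∃[ i ] ∃[ j ] ∃[ k ] (i < j × j < k × k ≤ suc (index-size fi) * suc (index-size fi) ×
                        R (x i) (x j) × R (x j) (x k))
pigeonhole₃ {X} (N , c , h) x = result
  where
  open ℕₚ.≤-Reasoning
  -- Unlike `R`, equality of colours can be inverted and composed, which links the pair inside the
  -- first block to the position in the second.
  exact : FiniteIndex (λ x y → c x ≡ c y)
  exact = N , c , λ eq → eq
  block : ∀ b → ∃[ i ] ∃[ j ] (i < j × j ≤ N × c (x (b * suc N + i)) ≡ c (x (b * suc N + j)))
  block b = pigeonhole exact λ i → x (b * suc N + i)
  position : ℕ → ℕ
  position b = b * suc N + proj₁ (block b)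
  result : ∃[ i ] ∃[ j ] ∃[ k ] _
  result with b , b′ , b<b′ , b′≤N , same ← pigeonhole exact (λ b → x (position b))
         with j , i<j , j≤N , same′ ← proj₂ (block b)
    = position b , b * suc N + j , position b′ , ℕₚ.+-monoʳ-< (b * suc N) i<j , j<k , k≤ ,
      h same′ , h (trans (sym same′) same)
    where
    j<k : b * suc N + j < position b′
    j<k = begin-strict
      b * suc N + j      ≤⟨ ℕₚ.+-monoʳ-≤ (b * suc N) j≤N ⟩
      b * suc N + N      <⟨ ℕₚ.+-monoʳ-< (b * suc N) (ℕₚ.n<1+n N) ⟩
      b * suc N + suc N  ≡⟨ ℕₚ.+-comm (b * suc N) (suc N) ⟩
      suc b * suc N      ≤⟨ ℕₚ.*-monoˡ-≤ (suc N) b<b′ ⟩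
      b′ * suc N         ≤⟨ ℕₚ.m≤m+n _ _ ⟩
      position b′        ∎
    k≤ : position b′ ≤ suc N * suc N
    k≤ with _ , i<j′ , j′≤N , _ ← proj₂ (block b′) = begin
      position b′           ≤⟨ ℕₚ.+-mono-≤ (ℕₚ.*-monoˡ-≤ (suc N) b′≤N)
                                 (ℕₚ.≤-trans (ℕₚ.<⇒≤ i<j′) (ℕₚ.≤-trans j′≤N (ℕₚ.n≤1+n N))) ⟩
      N * suc N + suc N     ≡⟨ ℕₚ.+-comm (N * suc N) (suc N) ⟩
      suc N * suc N         ∎

-- Chains of steps and their segments

module _ {S : Set} (E : S → S → Set) where

  data Chain : S → ℕ → S → Set where
    []  : ∀ {s} → Chain s 0 s
    _∷_ : ∀ {s t u m} → E s t → Chain t m u → Chain s (suc m) u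

module _ {S : Set} {E : S → S → Set} where

  at : ∀ {s m t} → Chain E s m t → ℕ → S
  at {s} _       zero    = s
  -- Beyond its end a chain repeats its last state, because the pigeonhole principle takes a
  -- sequence indexed by all of ℕ. The positions it returns are bounded by the length of the chain
  -- where it is applied.
  at {s} []      (suc _) = s
  at     (_ ∷ c) (suc i) = at c i

  at-last : ∀ {s m t} (c : Chain E s m t) → at c m ≡ t
  at-last []      = refl
  at-last (_ ∷ c) = at-last c

  segment : ∀ {s m t} (c : Chain E s m t) {i j} → i ≤ j → j ≤ m → Chain E (at c i) (j ∸ i) (at c j)
  segment c       {j = zero}  z≤n       _       = []
  segment (e ∷ c) {j = suc j} z≤n       (s≤s h) = e ∷ segment c z≤n h
  segment (e ∷ c)             (s≤s i≤j) (s≤s h) = segment c i≤j h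

  suffix : ∀ {s m t} (c : Chain E s m t) {i} → i ≤ m → Chain E (at c i) (m ∸ i) t
  suffix c i≤m = subst (Chain E _ _) (at-last c) (segment c i≤m ℕₚ.≤-refl)

length-induction : {A : Set} {P : List A → Set} →
  (∀ w → (∀ v → length v < length w → P v) → P w) → ∀ w → P w
length-induction {P = P} step =
  WF.All.wfRec (On.wellFounded length <-wellFounded) 0ℓ P λ w ih → step w λ v v<w → ih v<w

underlying-run : ∀ {k l} (T : Transducer k l) {p u q} →
  Automaton.Run (Transducer.underlying T) p u q ⇔ (∃[ a ] Transducer.OutputRun T p u a q)
underlying-run T = mk⇔ forth (λ (_ , r) → back r)
  where
  open Transducer T
  module U = Automaton underlying
  forth : ∀ {p u q} → U.Run p u q → ∃[ a ] OutputRun p u a q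
  forth (U.done refl)      = [] , done
  forth (U.step (_ , d) r) = _ , step d (proj₂ (forth r))
  back : ∀ {p u a q} → OutputRun p u a q → U.Run p u q
  back done       = U.done refl
  back (step d r) = U.step (_ , d) (back r)

-- Analysis of f through a transducer

module Realization {k l : ℕ} (f : Transduction k l) (T : Transducer k l) (realizes : Realizes T f) where
  open Transduction f
  open Transducer T
  open Canonical f

  run-++ : ∀ {p q r u v a b} → OutputRun p u a q → OutputRun q v b r → OutputRun p (u ++ v) (a ++ b) r
  run-++ done s = s
  run-++ {v = v} {b = b} (step {o = o} {x = x} d r) s =
    subst (λ y → OutputRun _ _ y _) (sym (++-assoc o x b)) (step d (run-++ r s))

  run-split : ∀ {p r} u {v c} → OutputRun p (u ++ v) c r →
    ∃[ q ] ∃[ a ] ∃[ b ] (OutputRun p u a q × OutputRun q v b r × c ≡ a ++ b)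
  run-split []      r = _ , [] , _ , done , r , refl
  run-split (σ ∷ u) (step {o = o} d r) with q , a , b , r₁ , r₂ , refl ← run-split u r =
    q , o ++ a , b , step d r₁ , r₂ , sym (++-assoc o a b)

  run-^ : ∀ {p u a} m → OutputRun p u a p → OutputRun p (u ^ m) (a ^ m) p
  run-^ zero    r = done
  run-^ (suc m) r = run-++ r (run-^ m r)

  Reaches : Word k → Word l → Fin size → Set
  Reaches x a p = ∃[ i ] ∃[ o ] ∃[ s ] (init i ≡ just o × OutputRun i x s p × a ≡ o ++ s)

  Accepts : Fin size → Word k → Word l → Set
  Accepts p w b = ∃[ q ] ∃[ s ] ∃[ t ] (OutputRun p w s q × final q ≡ just t × b ≡ s ++ t)

  reach-++ : ∀ {x y a c p q} → Reaches x a p → OutputRun p y c q → Reaches (x ++ y) (a ++ c) q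
  reach-++ {c = c} (i , o , s , hi , r , refl) r′ = i , o , s ++ c , hi , run-++ r r′ , ++-assoc o s c

  accept-++ : ∀ {y w c b p q} → OutputRun p y c q → Accepts q w b → Accepts p (y ++ w) (c ++ b)
  accept-++ {c = c} r′ (q , s , t , r , hf , refl) = q , c ++ s , t , run-++ r′ r , hf , sym (++-assoc c s t)

  accept-split : ∀ {p} y {w b} → Accepts p (y ++ w) b →
    ∃[ q ] ∃[ c ] ∃[ d ] (OutputRun p y c q × Accepts q w d × b ≡ c ++ d)
  accept-split y (q , s , t , r , hf , refl) with p , c , d , r₁ , r₂ , refl ← run-split y r =
    p , c , d ++ t , r₁ , (q , d , t , r₂ , hf , refl) , ++-assoc c d t

  graph-intro : ∀ {x w a b p} → Reaches x a p → Accepts p w b → graph (x ++ w) (a ++ b)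
  graph-intro {x} {w} (i , o , s , hi , r , refl) (q , s′ , t , r′ , hf , refl) =
    to (realizes (x ++ w) _) (i , q , o , s ++ s′ , t , hi , run-++ r r′ , hf ,
      trans (++-assoc o s (s′ ++ t)) (cong (o ++_) (sym (++-assoc s s′ t))))

  graph-elim : ∀ x {w y} → graph (x ++ w) y →
    ∃[ p ] ∃[ a ] ∃[ b ] (Reaches x a p × Accepts p w b × y ≡ a ++ b)
  graph-elim x {w} g with i , q , o , s , t , hi , r , hf , refl ← from (realizes (x ++ w) _) g
    with p , a , b , r₁ , r₂ , refl ← run-split x r =
    p , o ++ a , b ++ t , (i , o , a , hi , r₁ , refl) , (q , b , t , r₂ , hf , refl) ,
    trans (cong (o ++_) (++-assoc a b t)) (sym (++-assoc o a (b ++ t)))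

  -- Effectivity

  opaque
    runs : ∀ p u → Listable (λ ((c , q) : Word l × Fin size) → OutputRun p u c q)
    runs p [] = listable-⇔ (λ { (c , q) → mk⇔ (λ { refl → done }) (λ { done → refl }) })
                  (listable-singleton ([] , p))
    runs p (σ ∷ u) = listable-⇔
      (λ _ → mk⇔ (λ { (_ , ((_ , d) , r) , refl) → step d r })
                 (λ { (step d r) → ((_ , _) , (_ , _)) , ((tt , d) , r) , refl }))
      (listable-image (λ (((r , o) , (x , q)) : (Fin size × Word l) × (Word l × Fin size)) → o ++ x , q)
        (listable-Σ (listable-Σ listable-fin λ r → listable-just (δ p σ r)) λ (r , _) → runs r u))

  opaque
    reaches : ∀ x → Listable (λ ((a , p) : Word l × Fin size) → Reaches x a p)
    reaches x = listable-⇔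
      (λ _ → mk⇔ (λ { (((i , o) , (s , p)) , ((_ , hi) , r) , refl) → i , o , s , hi , r , refl })
                 (λ { (i , o , s , hi , r , refl) → ((i , o) , (s , _)) , ((tt , hi) , r) , refl }))
      (listable-image (λ (((i , o) , (s , p)) : (Fin size × Word l) × (Word l × Fin size)) → o ++ s , p)
        (listable-Σ (listable-Σ listable-fin λ i → listable-just (init i)) λ (i , _) → runs i x))

  opaque
    accepts : ∀ p w → Listable (Accepts p w)
    accepts p w = listable-⇔
      (λ _ → mk⇔ (λ { (((s , q) , t) , (r , hf) , refl) → q , s , t , r , hf , refl })
                 (λ { (q , s , t , r , hf , refl) → ((s , q) , t) , (r , hf) , refl }))
      (listable-image (λ (((s , q) , t) : (Word l × Fin size) × Word l) → s ++ t)
        (listable-Σ (runs p w) λ (_ , q) → listable-just (final q)))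

  opaque
    outputs : ∀ w → Listable (graph w)
    outputs w = listable-⇔
      (λ _ → mk⇔ (λ { (_ , (r , a) , refl) → graph-intro {[]} r a })
                 (λ g → let (p , a , b , r , acc , eq) = graph-elim [] g in
                        ((a , p) , b) , (r , acc) , eq))
      (listable-image (λ (((a , p) , b) : (Word l × Fin size) × Word l) → a ++ b)
        (listable-Σ (reaches []) λ (_ , p) → accepts p w))

  opaque
    dom? : ∀ w → Dec (Dom w)
    dom? w = listable-∃? (outputs w)

  opaque
    dom-⇔? : ∀ u v → Dec (Dom u ⇔ Dom v)
    dom-⇔? u v = map′ (λ (a , b) → mk⇔ a b) (λ e → to e , from e)
                   ((dom? u →-dec dom? v) ×-dec (dom? v →-dec dom? u))

  -- Words accepted from the same states

  SameAccept : Word k → Word k → Set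
  SameAccept u v = ∀ p → ∃ (Accepts p u) ⇔ ∃ (Accepts p v)

  opaque
    fi-accept : FiniteIndex SameAccept
    fi-accept with N , c , h ← fi-∀ {Φ = λ p u → ∃ (Accepts p u)} listable-fin
                                  (λ p u → listable-∃? (accepts p u))
      = N , c , λ eq p → h eq tt

  opaque
    accept-bound : ∀ u → ∃[ B ] (∀ {p b} → Accepts p u b → length b ≤ B)
    accept-bound u with B , h ← listable-bounded (listable-Σ listable-fin λ p → accepts p u)
                                                 (λ (_ , b) → length b)
      = B , λ acc → h (tt , acc)

  -- The run on `w` that serves for `u` can be continued on `v`, and by functionality its output is
  -- f(wv). The two values thus share the output on `w` and differ only in their bounded ends.
  sameAccept⇒close : ∀ {u v} → SameAccept u v → Close f u v
  sameAccept⇒close {u} {v} s = (λ w → mk⇔ (transport s w) (transport (λ p → ⇔.sym (s p)) w)) ,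
    B + B′ , bound
    where
    transport : ∀ {u v} → SameAccept u v → ∀ w → Dom (w ++ u) → Dom (w ++ v)
    transport s w (_ , g) = let (p , _ , b , r , acc , _) = graph-elim w g in
      _ , graph-intro r (proj₂ (to (s p) (b , acc)))
    B  = proj₁ (accept-bound u)
    B′ = proj₁ (accept-bound v)
    bound : ∀ w x y → graph (w ++ u) x → graph (w ++ v) y → dist x y ≤ B + B′
    bound w x y gx gy
      with p , a , b , r , acc , refl ← graph-elim w gx
      with b′ , acc′ ← to (s p) (b , acc)
      with refl ← functional gy (graph-intro r acc′)
      = ℕₚ.≤-trans (ℕₚ.≤-reflexive (dist-++ a b b′))
          (ℕₚ.≤-trans (dist-≤ b b′)
            (ℕₚ.+-mono-≤ (proj₂ (accept-bound u) acc) (proj₂ (accept-bound v) acc′)))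

  -- Pairs of runs on a common word

  -- The input and the outputs are those still to come, so two positions of a chain determine the
  -- factors read and written between them.
  record Config : Set where
    constructor config
    field
      state₁ state₂ : Fin size
      input : Word k
      output₁ output₂ : Word l
  open Config

  -- Loops are sought at block boundaries: with letters as blocks to shorten words, and with copies
  -- of one power to obtain loops on powers.
  data Blocks (B : Word k → Set) : ℕ → Word k → Set where
    []  : Blocks B 0 []
    _∷_ : ∀ {x m y} → B x → Blocks B m y → Blocks B (suc m) (x ++ y)

  PairRun : (p p′ : Fin size) (x : Word k) (a a′ : Word l) (q q′ : Fin size) → Set
  PairRun p p′ x a a′ q q′ = OutputRun p x a q × OutputRun p′ x a′ q′

  record Segment (P : Word k → Set) (C D : Config) : Set where
    constructor mkSegment
    field
      {word} : Word k
      {out₁ out₂} : Word l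
      property : P word
      input≡ : input C ≡ word ++ input D
      output₁≡ : output₁ C ≡ out₁ ++ output₁ D
      output₂≡ : output₂ C ≡ out₂ ++ output₂ D
      pairRun : PairRun (state₁ C) (state₂ C) word out₁ out₂ (state₁ D) (state₂ D)

  module _ {B : Word k → Set} where

    run⇒chain : ∀ {p p′ q q′ m x s s′} → Blocks B m x → PairRun p p′ x s s′ q q′ →
      Chain (Segment B) (config p p′ x s s′) m (config q q′ [] [] [])
    run⇒chain [] (done , done) = []
    run⇒chain (_∷_ {x} b bs) (r , r′)
      with q , a , c , r₁ , r₂ , refl ← run-split x r
         | q′ , a′ , c′ , r₁′ , r₂′ , refl ← run-split x r′
      = mkSegment b refl refl refl (r₁ , r₁′) ∷ run⇒chain bs (r₂ , r₂′)

    chain⇒segment : ∀ {C m D} → Chain (Segment B) C m D → Segment (Blocks B m) C D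
    chain⇒segment [] = mkSegment [] refl refl refl (done , done)
    chain⇒segment (mkSegment {x} {a} {a′} b refl refl refl (r , r′) ∷ c)
      with mkSegment {y} {d} {d′} bs refl refl refl (s , s′) ← chain⇒segment c
      = mkSegment (b ∷ bs) (sym (++-assoc x y _)) (sym (++-assoc a d _)) (sym (++-assoc a′ d′ _))
          (run-++ r s , run-++ r′ s′)

  opaque
    fi-states : FiniteIndex (λ C D → state₁ C ≡ state₁ D × state₂ C ≡ state₂ D)
    fi-states = fi-× (fi-on state₁ fi-fin) (fi-on state₂ fi-fin)

  loopBound : ℕ
  loopBound = index-size fi-states

  -- `i+j≤` keeps the way to the loop and the loop itself short, as `ShortTwin` demands. The rest
  -- `z` is unbounded and has to be shortened separately.
  record PairLoop (B : Word k → Set) (p p′ : Fin size) (u : Word k) (s s′ : Word l)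
                  (q q′ : Fin size) : Set where
    constructor mkPairLoop
    field
      {i j} : ℕ
      {x y z} : Word k
      {a a′ c c′ b b′} : Word l
      {r r′} : Fin size
      0<j : 0 < j
      i+j≤ : i + j ≤ loopBound
      blocks-x : Blocks B i x
      blocks-y : Blocks B j y
      u≡ : u ≡ x ++ y ++ z
      s≡ : s ≡ a ++ c ++ b
      s′≡ : s′ ≡ a′ ++ c′ ++ b′
      run-x : PairRun p p′ x a a′ r r′
      run-y : PairRun r r′ y c c′ r r′
      run-z : PairRun r r′ z b b′ q q′

  find-loop : ∀ {B m p p′ u s s′ q q′} → loopBound ≤ m → Blocks B m u → PairRun p p′ u s s′ q q′ →
    PairLoop B p p′ u s s′ q q′
  find-loop {B} {m} N≤m bs pr
    with ch ← run⇒chain bs pr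
    with i , j , i<j , j≤N , same₁ , same₂ ← pigeonhole fi-states (at ch)
    with j≤m ← ℕₚ.≤-trans j≤N N≤m
    with mkSegment {x} {a} {a′} bx ix ax a′x rx ← chain⇒segment (segment ch z≤n (ℕₚ.≤-trans (ℕₚ.<⇒≤ i<j) j≤m))
       | mkSegment {y} {c} {c′} by iy ay a′y (ry , ry′) ← chain⇒segment (segment ch (ℕₚ.<⇒≤ i<j) j≤m)
       | mkSegment {z} {b} {b′} _ iz az a′z (rz , rz′) ← chain⇒segment (suffix ch j≤m)
    = mkPairLoop (ℕₚ.m<n⇒0<n∸m i<j) (subst (_≤ loopBound) (sym (ℕₚ.m+[n∸m]≡n (ℕₚ.<⇒≤ i<j))) j≤N)
        bx by
        (trans ix (cong (x ++_) (trans iy (cong (y ++_) (trans iz (++-identityʳ z))))))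
        (trans ax (cong (a ++_) (trans ay (cong (c ++_) (trans az (++-identityʳ b))))))
        (trans a′x (cong (a′ ++_) (trans a′y (cong (c′ ++_) (trans a′z (++-identityʳ b′))))))
        rx
        (subst (λ r → OutputRun _ y c r) (sym same₁) ry ,
         subst (λ r → OutputRun _ y c′ r) (sym same₂) ry′)
        (subst (λ r → OutputRun r z b _) (sym same₁) rz ,
         subst (λ r → OutputRun r z b′ _) (sym same₂) rz′)

  Letter : Word k → Set
  Letter x = length x ≡ 1

  letters : ∀ u → Blocks Letter (length u) u
  letters []      = []
  letters (σ ∷ u) = refl {x = 1} ∷ letters u

  letters-length : ∀ {m u} → Blocks Letter m u → length u ≡ m
  letters-length []             = refl
  letters-length (_∷_ {x} b bs) = trans (length-++ x) (cong₂ _+_ b (letters-length bs))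

  powers : ∀ w m → Blocks (_≡ w) m (w ^ m)
  powers w zero    = []
  powers w (suc m) = refl ∷ powers w m

  powers-≡ : ∀ {w m u} → Blocks (_≡ w) m u → u ≡ w ^ m
  powers-≡ []          = refl
  powers-≡ (refl ∷ bs) = cong (_ ++_) (powers-≡ bs)

  -- Delays of pairs of runs

  close-twin : ∀ {u v x a a′ p p′ y c c′ b b′} → Close f u v →
    Reaches x a p → Reaches x a′ p′ → PairRun p p′ y c c′ p p′ → Accepts p u b → Accepts p′ v b′ →
    SameDelay a a′ (a ++ c) (a′ ++ c′)
  close-twin {u} {v} {x} {a} {a′} {y = y} {c} {c′} {b} {b′} (_ , B , bound) ra ra′ (r , r′) acc acc′ =
    twin {a = a} {c} {b} {a′} {c′} {b′} λ m → subst₂ (λ s t → dist s t ≤ B)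
      (++-assoc a (c ^ m) b) (++-assoc a′ (c′ ^ m) b′)
      (bound (x ++ (y ^ m)) _ _ (graph-intro (reach-++ ra (run-^ m r)) acc)
                                (graph-intro (reach-++ ra′ (run-^ m r′)) acc′))

  cut-length : ∀ (x : Word k) {y z} → 0 < length y → length (x ++ z) < length (x ++ y ++ z)
  cut-length []      {y} {z} h = subst (length z <_) (sym (length-++ y)) (ℕₚ.m<n+m (length z) h)
  cut-length (σ ∷ x)     h = s≤s (cut-length x h)

  letters-nonempty : ∀ {m u} → 0 < m → Blocks Letter m u → 0 < length u
  letters-nonempty h bs = subst (0 <_) (sym (letters-length bs)) h

  shorten-run : ∀ z {p p′ b b′ q q′} → PairRun p p′ z b b′ q q′ →
    ∃[ z₀ ] ∃[ b₀ ] ∃[ b₀′ ] (length z₀ ≤ loopBound × PairRun p p′ z₀ b₀ b₀′ q q′)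
  shorten-run = length-induction λ z shorter pr → shorten z shorter pr (length z ℕₚ.≤? loopBound)
    where
    Short : Word k → Set
    Short z = ∀ {p p′ b b′ q q′} → PairRun p p′ z b b′ q q′ →
      ∃[ z₀ ] ∃[ b₀ ] ∃[ b₀′ ] (length z₀ ≤ loopBound × PairRun p p′ z₀ b₀ b₀′ q q′)
    shorten : ∀ z → (∀ v → length v < length z → Short v) →
      ∀ {p p′ b b′ q q′} → PairRun p p′ z b b′ q q′ → Dec (length z ≤ loopBound) →
      ∃[ z₀ ] ∃[ b₀ ] ∃[ b₀′ ] (length z₀ ≤ loopBound × PairRun p p′ z₀ b₀ b₀′ q q′)
    shorten z shorter pr (yes h) = z , _ , _ , h , pr
    shorten z shorter pr (no ¬h)
      with mkPairLoop {x = x} 0<j _ _ by refl _ _ (rx , rx′) _ (rz , rz′)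
             ← find-loop (ℕₚ.<⇒≤ (ℕₚ.≰⇒> ¬h)) (letters z) pr
      = shorter _ (cut-length x (letters-nonempty 0<j by)) (run-++ rx rz , run-++ rx′ rz′)

  -- The conclusion of close-twin, for short words only: a decidable condition.
  ShortTwin : Word k → Word k → Set
  ShortTwin u v =
    ∀ {x} → length x ≤ loopBound →
    ∀ {(a , p) : Word l × Fin size} → Reaches x a p →
    ∀ {(a′ , p′) : Word l × Fin size} → Reaches x a′ p′ →
    ∀ {y} → length y ≤ loopBound →
    ∀ {(c , q) : Word l × Fin size} → OutputRun p y c q →
    ∀ {(c′ , q′) : Word l × Fin size} → OutputRun p′ y c′ q′ →
    ∀ {z} → length z ≤ loopBound →
    ∀ {(b , r) : Word l × Fin size} → OutputRun p z b r →
    ∀ {(b′ , r′) : Word l × Fin size} → OutputRun p′ z b′ r′ →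
    ∀ {d} → Accepts r u d → ∀ {d′} → Accepts r′ v d′ →
    q ≡ p × q′ ≡ p′ → SameDelay a a′ (a ++ c) (a′ ++ c′)

  opaque
    shortTwin? : ∀ u v → Dec (ShortTwin u v)
    shortTwin? u v =
      listable-∀? (listable-words loopBound) λ x _ →
      listable-∀? (reaches x) λ (a , p) _ → listable-∀? (reaches x) λ (a′ , p′) _ →
      listable-∀? (listable-words loopBound) λ y _ →
      listable-∀? (runs p y) λ (c , q) _ → listable-∀? (runs p′ y) λ (c′ , q′) _ →
      listable-∀? (listable-words loopBound) λ z _ →
      listable-∀? (runs p z) λ (_ , r) _ → listable-∀? (runs p′ z) λ (_ , r′) _ →
      listable-∀? (accepts r u) λ _ _ → listable-∀? (accepts r′ v) λ _ _ →
      ((q Finₚ.≟ p) ×-dec (q′ Finₚ.≟ p′)) →-dec sd? a a′ (a ++ c) (a′ ++ c′)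

  close⇒shortTwin : ∀ {u v} → Close f u v → ShortTwin u v
  close⇒shortTwin c _ ra ra′ _ ry ry′ {z} _ rz rz′ acc acc′ (refl , refl) =
    close-twin (close-++ˡ z c) ra ra′ (ry , ry′) (accept-++ rz acc) (accept-++ rz′ acc′)

  ShortDelay : Fin size → Fin size → Word l → Word l → Set
  ShortDelay p p′ a a′ = ∃[ x₀ ] ∃[ a₀ ] ∃[ a₀′ ]
    (length x₀ ≤ loopBound × Reaches x₀ a₀ p × Reaches x₀ a₀′ p′ × SameDelay a₀ a₀′ a a′)

  opaque
    -- `ShortTwin` says that deleting a loop preserves the delay, so induction on the length ends at
    -- a short word. Hence pairs of states from which `u` and `v` are accepted occur with finitely
    -- many delays only.
    short-delay : ∀ {u v} → ShortTwin u v → ∀ {p p′ b b′} → Accepts p u b → Accepts p′ v b′ →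
      ∀ x {a a′} → Reaches x a p → Reaches x a′ p′ → ShortDelay p p′ a a′
    short-delay {u} {v} tw {p} {p′} acc acc′ =
      length-induction λ x shorter ra ra′ → shorten x shorter ra ra′ (length x ℕₚ.≤? loopBound)
      where
      shorten : ∀ x →
          (∀ y → length y < length x → ∀ {a a′} → Reaches y a p → Reaches y a′ p′ → ShortDelay p p′ a a′) →
        ∀ {a a′} → Reaches x a p → Reaches x a′ p′ → Dec (length x ≤ loopBound) → ShortDelay p p′ a a′
      shorten x shorter {a} {a′} ra ra′ (yes h) = x , a , a′ , h , ra , ra′ , sd-refl a a′
      shorten x shorter (i , o , s , hi , r , refl) (i′ , o′ , s′ , hi′ , r′ , refl) (no ¬h)
        with mkPairLoop {x = x₁} {y} {z} {a} {a′} {c} {c′} {b} {b′}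
               0<j i+j≤ bx by refl refl refl (rx , rx′) (ry , ry′) (rz , rz′)
               ← find-loop (ℕₚ.<⇒≤ (ℕₚ.≰⇒> ¬h)) (letters x) (r , r′)
        -- The delay at the loop does not involve `z`: any short way from the loop to `p` and `p′`
        -- makes `tw` applicable.
        with z₀ , _ , _ , z₀≤ , rz₀ , rz₀′ ← shorten-run z (rz , rz′)
        with x₀ , a₀ , a₀′ , x₀≤ , ra₀ , ra₀′ , sd ←
               shorter (x₁ ++ z) (cut-length x₁ (letters-nonempty 0<j by))
                 (i , o , a ++ b , hi , run-++ rx rz , refl) (i′ , o′ , a′ ++ b′ , hi′ , run-++ rx′ rz′ , refl)
        = x₀ , a₀ , a₀′ , x₀≤ , ra₀ , ra₀′ , sd-trans sd looped
        where
        twinned : SameDelay (o ++ a) (o′ ++ a′) ((o ++ a) ++ c) ((o′ ++ a′) ++ c′)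
        twinned = tw (subst (_≤ loopBound) (sym (letters-length bx)) (ℕₚ.≤-trans (ℕₚ.m≤m+n _ _) i+j≤))
          (i , o , a , hi , rx , refl) (i′ , o′ , a′ , hi′ , rx′ , refl)
          (subst (_≤ loopBound) (sym (letters-length by)) (ℕₚ.≤-trans (ℕₚ.m≤n+m _ _) i+j≤))
          ry ry′ z₀≤ rz₀ rz₀′ acc acc′ (refl , refl)
        looped : SameDelay (o ++ a ++ b) (o′ ++ a′ ++ b′) (o ++ a ++ c ++ b) (o′ ++ a′ ++ c′ ++ b′)
        looped = subst₂ (λ s t → SameDelay s t (o ++ a ++ c ++ b) (o′ ++ a′ ++ c′ ++ b′))
          (++-assoc o a b) (++-assoc o′ a′ b′)
          (subst₂ (SameDelay ((o ++ a) ++ b) ((o′ ++ a′) ++ b′))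
            (trans (++-assoc (o ++ a) c b) (++-assoc o a (c ++ b)))
            (trans (++-assoc (o′ ++ a′) c′ b′) (++-assoc o′ a′ (c′ ++ b′)))
            (sd-++ʳ b b′ twinned))

  -- Left representatives

  DelaySample : (Fin size × Fin size) × (Word l × Word l) → Set
  DelaySample ((p , p′) , (a , a′)) = ∃[ x ] (length x ≤ loopBound × Reaches x a p × Reaches x a′ p′)

  opaque
    delaySamples : Listable DelaySample
    delaySamples = listable-⇔
      (λ _ → mk⇔ (λ { ((x , (_ , _) , _) , (h , r , r′) , refl) → x , h , r , r′ })
                 (λ { (x , h , r , r′) → (x , (_ , _) , (_ , _)) , (h , r , r′) , refl }))
      (listable-image (λ ((_ , (a , p) , (a′ , p′)) : Word k × (Word l × Fin size) × (Word l × Fin size)) →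
                         (p , p′) , (a , a′))
        (listable-Σ (listable-words loopBound) λ x → listable-Σ (reaches x) λ _ → reaches x))

  HasDelay : (Fin size × Fin size) × (Word l × Word l) → Word k → Set
  HasDelay ((p , p′) , (a₀ , a₀′)) x =
    ∃[ a ] ∃[ a′ ] (Reaches x a p × Reaches x a′ p′ × SameDelay a₀ a₀′ a a′)

  hasDelay? : ∀ d x → Dec (HasDelay d x)
  hasDelay? ((p , p′) , (a₀ , a₀′)) x = map′
    (λ { (((a , _) , (a′ , _)) , (r , r′) , refl , refl , s) → a , a′ , r , r′ , s })
    (λ { (a , a′ , r , r′ , s) → ((a , p) , (a′ , p′)) , (r , r′) , refl , refl , s })
    (listable-∃? (listable-filter {P = λ ((a , q) , (a′ , q′)) → q ≡ p × q′ ≡ p′ × SameDelay a₀ a₀′ a a′}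
      (λ ((a , q) , (a′ , q′)) → (q Finₚ.≟ p) ×-dec ((q′ Finₚ.≟ p′) ×-dec sd? a₀ a₀′ a a′))
      (listable-Σ (reaches x) λ _ → reaches x)))

  SameDelays : Word k → Word k → Set
  SameDelays x y = ∀ {d} → DelaySample d → HasDelay d x ⇔ HasDelay d y

  opaque
    fi-delays : FiniteIndex SameDelays
    fi-delays = fi-∀ delaySamples hasDelay?

  -- By `short-delay` the delay of two runs on `u` that can be completed to `w₁` ↼ `w₂` is among the
  -- samples, so `v` has runs to the same two states with the same delay.
  sameDelays⇒simD : ∀ {u v} → SameDelays u v → SimD u v
  sameDelays⇒simD {u} {v} same =
    (λ w → mk⇔ (λ (_ , g) → dom same g) (λ (_ , g) → dom (λ d → ⇔.sym (same d)) g)) , delays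
    where
    transfer : ∀ {u v} → SameDelays u v → ∀ {w₁ w₂ p p′ a a′ b b′} → Close f w₁ w₂ →
      Reaches u a p → Reaches u a′ p′ → Accepts p w₁ b → Accepts p′ w₂ b′ →
      ∃[ c ] ∃[ c′ ] (Reaches v c p × Reaches v c′ p′ × SameDelay a a′ c c′)
    transfer {u} same c ra ra′ acc acc′
      with x₀ , a₀ , a₀′ , x₀≤ , ra₀ , ra₀′ , s ← short-delay (close⇒shortTwin c) acc acc′ u ra ra′
      with d , d′ , rd , rd′ , s′ ← to (same (x₀ , x₀≤ , ra₀ , ra₀′)) (_ , _ , ra , ra′ , s)
      = d , d′ , rd , rd′ , sd-trans (sd-sym s) s′
    dom : ∀ {u v w y} → SameDelays u v → graph (u ++ w) y → Dom (v ++ w)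
    dom {u} same g with p , a , b , ra , acc , _ ← graph-elim u g
      -- Pairing the run with itself yields just what the domain needs: `v` reaches `p` as well.
      with c , _ , rc , _ ← transfer same Close.refl ra ra acc acc = _ , graph-intro rc acc
    delays : ∀ {w₁ w₂} → Close f w₁ w₂ → ∀ {x₁ x₂ y₁ y₂} →
      graph (u ++ w₁) x₁ → graph (u ++ w₂) x₂ → graph (v ++ w₁) y₁ → graph (v ++ w₂) y₂ →
      SameDelay x₁ x₂ y₁ y₂
    delays cl gx₁ gx₂ gy₁ gy₂
      with p , a , b , ra , acc , refl ← graph-elim u gx₁
         | p′ , a′ , b′ , ra′ , acc′ , refl ← graph-elim u gx₂
      with c , c′ , rc , rc′ , s ← transfer same cl ra ra′ acc acc′
      with refl ← functional gy₁ (graph-intro rc acc) | refl ← functional gy₂ (graph-intro rc′ acc′)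
      = sd-++ʳ b b′ s

  cut : ∀ (u : Word k) i j → i < j → j ≤ length u → length (take i u ++ drop j u) < length u
  cut (σ ∷ u) zero    (suc j) _         (s≤s h) =
    s≤s (subst (_≤ length u) (sym (length-drop j u)) (ℕₚ.m∸n≤m (length u) j))
  cut (σ ∷ u) (suc i) (suc j) (s≤s i<j) (s≤s h) = s≤s (cut u i j i<j h)

  leftBound rightBound : ℕ
  leftBound  = index-size fi-delays
  rightBound = index-size fi-accept

  opaque
    -- Among the first `leftBound` + 1 prefixes of a longer word two have the same colour. The
    -- factor between them can be cut out since `SimD` is a right congruence.
    left-rep : ∀ u → ∃[ v ] (length v ≤ leftBound × SimD v u)
    left-rep = length-induction λ u shorter → shorten u shorter (length u ℕₚ.≤? leftBound)
      where
      shorten : ∀ u → (∀ v → length v < length u → ∃[ w ] (length w ≤ leftBound × SimD w v)) →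
        Dec (length u ≤ leftBound) → ∃[ v ] (length v ≤ leftBound × SimD v u)
      shorten u shorter (yes h) = u , h , simD-refl
      shorten u shorter (no ¬h)
        with i , j , i<j , j≤ , same ← pigeonhole fi-delays (λ i → take i u)
        with v , v≤ , s ← shorter (take i u ++ drop j u)
                            (cut u i j i<j (ℕₚ.≤-trans j≤ (ℕₚ.<⇒≤ (ℕₚ.≰⇒> ¬h))))
        = v , v≤ , simD-trans s (subst (SimD _) (take++drop≡id j u)
                     (simD-++ʳ (drop j u) (sameDelays⇒simD same)))

  opaque
    right-rep : ∀ u → ∃[ v ] (length v ≤ rightBound × Close f v u)
    right-rep = length-induction λ u shorter → shorten u shorter (length u ℕₚ.≤? rightBound)
      where
      shorten : ∀ u → (∀ v → length v < length u → ∃[ w ] (length w ≤ rightBound × Close f w v)) →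
        Dec (length u ≤ rightBound) → ∃[ v ] (length v ≤ rightBound × Close f v u)
      shorten u shorter (yes h) = u , h , Close.refl
      shorten u shorter (no ¬h)
        with i , j , i<j , j≤ , same ← pigeonhole fi-accept (λ i → drop i u)
        with v , v≤ , s ← shorter (take i u ++ drop j u)
                            (cut u i j i<j (ℕₚ.≤-trans j≤ (ℕₚ.<⇒≤ (ℕₚ.≰⇒> ¬h))))
        = v , v≤ , Close.trans s (subst (Close f _) (take++drop≡id i u)
                     (close-++ˡ (take i u) (Close.sym (sameAccept⇒close same))))

  -- Decidability of Close

  -- The distance depends on the delay alone, and the delays that matter are sampled by short words.
  -- `K` bounds these, while `M` and `M′` bound the outputs on `u` and `v`.
  shortTwin⇒bounded : ∀ {u v} → ShortTwin u v →
    ∃[ B ] (∀ w x y → graph (w ++ u) x → graph (w ++ v) y → dist x y ≤ B)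
  shortTwin⇒bounded {u} {v} tw
    with K , short ← listable-bounded delaySamples (λ (_ , (a , a′)) → dist a a′)
       | M , bound ← accept-bound u | M′ , bound′ ← accept-bound v
    = M + (K + M′) , bounded
    where
    dist-prefix : ∀ (a b : Word l) → dist (a ++ b) a ≡ length b
    dist-prefix a b = trans (cong (dist (a ++ b)) (sym (++-identityʳ a)))
                        (trans (dist-++ a b []) (dist-[]ʳ b))
    bounded : ∀ w x y → graph (w ++ u) x → graph (w ++ v) y → dist x y ≤ M + (K + M′)
    bounded w x y gx gy
      with p , a , b , ra , acc , refl ← graph-elim w gx
         | p′ , a′ , b′ , ra′ , acc′ , refl ← graph-elim w gy
      with x₀ , a₀ , a₀′ , x₀≤ , ra₀ , ra₀′ , s ← short-delay tw acc acc′ w ra ra′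
      = begin
        dist (a ++ b) (a′ ++ b′)                       ≤⟨ dist-triangle (a ++ b) a (a′ ++ b′) ⟩
        dist (a ++ b) a + dist a (a′ ++ b′)            ≤⟨ ℕₚ.+-mono-≤ (ℕₚ.≤-reflexive (dist-prefix a b))
                                                            (dist-triangle a a′ (a′ ++ b′)) ⟩
        length b + (dist a a′ + dist a′ (a′ ++ b′))
          ≡⟨ cong₂ (λ s t → length b + (s + t)) (sym (sd-dist s))
               (trans (dist-sym a′ (a′ ++ b′)) (dist-prefix a′ b′)) ⟩
        length b + (dist a₀ a₀′ + length b′)
          ≤⟨ ℕₚ.+-mono-≤ (bound acc) (ℕₚ.+-mono-≤ (short (x₀ , x₀≤ , ra₀ , ra₀′)) (bound′ acc′)) ⟩
        M + (K + M′)                                   ∎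
      where open ℕₚ.≤-Reasoning

  opaque
    -- For the domains, a left context may be replaced by its short representative, as words related
    -- by `SimD` have the same right contexts. The bound on distances is equivalent to `ShortTwin`.
    close? : ∀ u v → Dec (Close f u v)
    close? u v = map′ forth back (shortDom? ×-dec shortTwin? u v)
      where
      ShortDom : Set
      ShortDom = ∀ {w} → length w ≤ leftBound → Dom (w ++ u) ⇔ Dom (w ++ v)
      shortDom? : Dec ShortDom
      shortDom? = listable-∀? (listable-words leftBound) λ w _ → dom-⇔? (w ++ u) (w ++ v)
      forth : ShortDom × ShortTwin u v → Close f u v
      forth (d , tw) = (λ w → let (w₀ , w₀≤ , s) = left-rep w in
        ⇔.trans (⇔.sym (proj₁ s u)) (⇔.trans (d w₀≤) (proj₁ s v))) , shortTwin⇒bounded tw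
      back : Close f u v → ShortDom × ShortTwin u v
      back c = (λ {w} _ → proj₁ c w) , close⇒shortTwin c

  -- Pumping two consecutive loops

  -- Equal state pairs make the factors between positions loops of both runs. `SameAccept` on the
  -- remaining input ensures that deleting these factors stays within the ↼-class of the word.
  fi-configs : FiniteIndex (λ C D → (Config.state₁ C ≡ Config.state₁ D × Config.state₂ C ≡ Config.state₂ D) ×
                                    SameAccept (Config.input C) (Config.input D))
  fi-configs = fi-× fi-states (fi-on Config.input fi-accept)

  tripleBound : ℕ
  tripleBound = suc (index-size fi-configs) * suc (index-size fi-configs)

  PairAccept : (p p′ : Fin size) (w : Word k) (b b′ : Word l) → Set
  PairAccept p p′ w b b′ = Accepts p w b × Accepts p′ w b′

  -- w = x y z t with y and z read along loops; w₀ = x t, w₁ = x y t, w₂ = x z t.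
  record Triple (p p′ : Fin size) (w : Word k) (b b′ : Word l) : Set where
    constructor mkTriple
    field
      {w₀ w₁ w₂} : Word k
      {a c e g a′ c′ e′ g′} : Word l
      shorter₀ : length w₀ < length w
      shorter₁ : length w₁ < length w
      shorter₂ : length w₂ < length w
      close₀ : Close f w₀ w
      close₁ : Close f w₁ w
      close₂ : Close f w₂ w
      b≡  : b ≡ a ++ c ++ e ++ g
      b′≡ : b′ ≡ a′ ++ c′ ++ e′ ++ g′
      accept₀ : PairAccept p p′ w₀ (a ++ g) (a′ ++ g′)
      accept₁ : PairAccept p p′ w₁ (a ++ c ++ g) (a′ ++ c′ ++ g′)
      accept₂ : PairAccept p p′ w₂ (a ++ e ++ g) (a′ ++ e′ ++ g′)

  pair-accept-++ : ∀ {p p′ q q′ y w c c′ b b′} → PairRun p p′ y c c′ q q′ → PairAccept q q′ w b b′ →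
    PairAccept p p′ (y ++ w) (c ++ b) (c′ ++ b′)
  pair-accept-++ (r , r′) (acc , acc′) = accept-++ r acc , accept-++ r′ acc′

  opaque
    find-triple : ∀ {p p′ w b b′} → tripleBound ≤ length w → PairAccept p p′ w b b′ → Triple p p′ w b b′
    find-triple {p} {p′} {w} bound≤ ((q , s , o , r , hf , refl) , (q′ , s′ , o′ , r′ , hf′ , refl))
      with ch ← run⇒chain (letters w) (r , r′)
      with i , j , k , i<j , j<k , k≤ , ((ij , ij′) , ijᴬ) , ((jk , jk′) , jkᴬ) ← pigeonhole₃ fi-configs (at ch)
      with k≤m ← ℕₚ.≤-trans k≤ bound≤
      with config u u′ xᵢ oᵢ oᵢ′ ← at ch i
         | mkSegment {x} {a} {a′} _ refl refl refl rx
             ← chain⇒segment (segment ch {0} {i} z≤n (ℕₚ.≤-trans (ℕₚ.<⇒≤ i<j) (ℕₚ.≤-trans (ℕₚ.<⇒≤ j<k) k≤m)))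
         | cij ← segment ch (ℕₚ.<⇒≤ i<j) (ℕₚ.≤-trans (ℕₚ.<⇒≤ j<k) k≤m)
      with config v v′ xⱼ oⱼ oⱼ′ ← at ch j
         | cjk ← segment ch (ℕₚ.<⇒≤ j<k) k≤m
      with config w w′ xₖ oₖ oₖ′ ← at ch k
         | mkSegment {t} {h} {h′} _ refl refl refl (rt , rt′) ← chain⇒segment (suffix ch k≤m)
      with refl ← ij | refl ← ij′ | refl ← jk | refl ← jk′
      with mkSegment {y} {c} {c′} by refl refl refl ry ← chain⇒segment cij
         | mkSegment {z} {e} {e′} bz refl refl refl rz ← chain⇒segment cjk
      = mkTriple {w₀ = x ++ xₖ} {x ++ y ++ xₖ} {x ++ z ++ xₖ} {a} {c} {e} {oₖ ++ o} {a′} {c′} {e′} {oₖ′ ++ o′}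
          (ℕₚ.<-trans (cut-length x {z} {xₖ} 0<z) (cut-length x {y} {z ++ xₖ} 0<y))
          (subst₂ (λ m n → m < n) (cong length (++-assoc x y xₖ)) (cong length (++-assoc x y (z ++ xₖ)))
            (cut-length (x ++ y) {z} {xₖ} 0<z))
          (cut-length x {y} {z ++ xₖ} 0<y)
          (close-++ˡ x (Close.trans closeₖⱼ closeⱼᵢ))
          (close-++ˡ x (close-++ˡ y closeₖⱼ))
          (close-++ˡ x closeⱼᵢ)
          (assoc a c e oₖ o) (assoc a′ c′ e′ oₖ′ o′)
          (pair-accept-++ rx rest) (pair-accept-++ rx (pair-accept-++ ry rest))
          (pair-accept-++ rx (pair-accept-++ rz rest))
      where
      0<y : 0 < length y
      0<y = letters-nonempty (ℕₚ.m<n⇒0<n∸m i<j) by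
      0<z : 0 < length z
      0<z = letters-nonempty (ℕₚ.m<n⇒0<n∸m j<k) bz
      closeₖⱼ : Close f xₖ (z ++ xₖ)
      closeₖⱼ = Close.sym (sameAccept⇒close jkᴬ)
      closeⱼᵢ : Close f (z ++ xₖ) (y ++ z ++ xₖ)
      closeⱼᵢ = Close.sym (sameAccept⇒close ijᴬ)
      rest : PairAccept u u′ xₖ (oₖ ++ o) (oₖ′ ++ o′)
      rest = (q , oₖ , o , run-++ rt done , hf , refl) , (q′ , oₖ′ , o′ , run-++ rt′ done , hf′ , refl)
      assoc : ∀ (a c e g o : Word l) → (a ++ c ++ e ++ g) ++ o ≡ a ++ c ++ e ++ g ++ o
      assoc a c e g o = trans (++-assoc a _ o) (cong (a ++_)
        (trans (++-assoc c _ o) (cong (c ++_) (++-assoc e g o))))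

  -- Decidability of SimD

  Agree : (u v w₁ w₂ : Word k) → Set
  Agree u v w₁ w₂ = ∀ {x₁} → graph (u ++ w₁) x₁ → ∀ {x₂} → graph (u ++ w₂) x₂ →
                    ∀ {y₁} → graph (v ++ w₁) y₁ → ∀ {y₂} → graph (v ++ w₂) y₂ → SameDelay x₁ x₂ y₁ y₂

  agree-swap : ∀ {u v w₁ w₂} → Agree u v w₁ w₂ → Agree u v w₂ w₁
  agree-swap h gx₁ gx₂ gy₁ gy₂ = sd-swap (h gx₂ gx₁ gy₂ gy₁)

  -- With `w₂` fixed, a long `w₁` is cut into x y z t. The shorter words x t, x y t and x z t lie in
  -- its class, and `sd-pump` assembles their agreement into that of `w₁`.
  agree-extend : ∀ {u v w₂} → (∀ {w₁} → length w₁ ≤ tripleBound → Close f w₁ w₂ → Agree u v w₁ w₂) →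
    ∀ w₁ → Close f w₁ w₂ → Agree u v w₁ w₂
  agree-extend {u} {v} {w₂} short = length-induction λ w shorter → extend w shorter (length w ℕₚ.≤? tripleBound)
    where
    extend : ∀ w → (∀ w′ → length w′ < length w → Close f w′ w₂ → Agree u v w′ w₂) →
      Dec (length w ≤ tripleBound) → Close f w w₂ → Agree u v w w₂
    extend w shorter (yes h) cl = short h cl
    extend w shorter (no ¬h) cl gx₁ gx₂ gy₁ gy₂
      with p , d , b , r , acc , refl ← graph-elim u gx₁
         | p′ , d′ , b′ , r′ , acc′ , refl ← graph-elim v gy₁
      with mkTriple {w₀} {w₁} {_} {a} {c} {e} {g} {a′} {c′} {e′} {g′} l₀ l₁ l₂ c₀ c₁ c₂ refl refl
                    (h₀ , h₀′) (h₁ , h₁′) (h₂ , h₂′)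
             ← find-triple (ℕₚ.<⇒≤ (ℕₚ.≰⇒> ¬h)) (acc , acc′)
      = subst₂ (λ s t → SameDelay s _ t _) (++-assoc d a (c ++ e ++ g)) (++-assoc d′ a′ (c′ ++ e′ ++ g′))
          (sd-pump (d ++ a) c e g (d′ ++ a′) c′ e′ g′
            (agree l₀ c₀ a g a′ g′ h₀ h₀′)
            (agree l₁ c₁ a (c ++ g) a′ (c′ ++ g′) h₁ h₁′)
            (agree l₂ c₂ a (e ++ g) a′ (e′ ++ g′) h₂ h₂′))
      where
      agree : ∀ {w′} → length w′ < length w → Close f w′ w → ∀ a g a′ g′ →
        Accepts p w′ (a ++ g) → Accepts p′ w′ (a′ ++ g′) →
        SameDelay ((d ++ a) ++ g) _ ((d′ ++ a′) ++ g′) _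
      agree l c a g a′ g′ h h′ = subst₂ (λ s t → SameDelay s _ t _)
        (sym (++-assoc d a g)) (sym (++-assoc d′ a′ g′))
        (shorter _ l (Close.trans c cl) (graph-intro r h) gx₂ (graph-intro r′ h′) gy₂)

  ShortAgree : Word k → Word k → Set
  ShortAgree u v = (∀ {w} → length w ≤ rightBound → Dom (u ++ w) ⇔ Dom (v ++ w)) ×
    (∀ {w₁} → length w₁ ≤ tripleBound → ∀ {w₂} → length w₂ ≤ tripleBound → Close f w₁ w₂ → Agree u v w₁ w₂)

  opaque
    shortAgree? : ∀ u v → Dec (ShortAgree u v)
    shortAgree? u v =
      listable-∀? (listable-words rightBound) (λ w _ → dom-⇔? (u ++ w) (v ++ w)) ×-dec
      (listable-∀? (listable-words tripleBound) λ w₁ _ → listable-∀? (listable-words tripleBound) λ w₂ _ →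
       close? w₁ w₂ →-dec
       (listable-∀? (outputs (u ++ w₁)) λ x₁ _ → listable-∀? (outputs (u ++ w₂)) λ x₂ _ →
        listable-∀? (outputs (v ++ w₁)) λ y₁ _ → listable-∀? (outputs (v ++ w₂)) λ y₂ _ → sd? x₁ x₂ y₁ y₂))

  shortAgree⇒simD : ∀ {u v} → ShortAgree u v → SimD u v
  shortAgree⇒simD {u} {v} (d , h) =
      (λ w → let (w₀ , w₀≤ , c) = right-rep w in
             ⇔.trans (⇔.sym (proj₁ (close-++ˡ u c) [])) (⇔.trans (d w₀≤) (proj₁ (close-++ˡ v c) [])))
    , λ {w₁} {w₂} c gx₁ gx₂ gy₁ gy₂ → agree w₁ w₂ c gx₁ gx₂ gy₁ gy₂
    where
    agree : ∀ w₁ w₂ → Close f w₁ w₂ → Agree u v w₁ w₂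
    -- `agree-extend` lifts the length bound on the first word only; `agree-swap` lets it act on
    -- each of the two in turn.
    agree w₁ w₂ = agree-extend {u} {v} (λ {x₁} x₁≤ c₁ → agree-swap {u} {v} {w₂} {x₁}
      (agree-extend {u} {v} (λ {x₂} x₂≤ c₂ → agree-swap {u} {v} {x₁} {x₂} (h x₁≤ x₂≤ (Close.sym c₂)))
        w₂ (Close.sym c₁))) w₁

  opaque
    simD? : ∀ u v → Dec (SimD u v)
    simD? u v = map′ shortAgree⇒simD
      (λ s → (λ {w} _ → proj₁ s w) , λ _ _ c gx₁ gx₂ gy₁ gy₂ → proj₂ s c gx₁ gx₂ gy₁ gy₂)
      (shortAgree? u v)

  -- Computation of the longest common prefixes

  ClassOutput : (w u : Word k) → Word l → Set
  ClassOutput w u y = ∃[ v ] (Close f v w × graph (u ++ v) y)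

  -- The analogue of `sd-pump` for prefixes. If `z` = as, then s ⊑ g and s ⊑ cg give s ⊑ cs, and s ⊑
  -- eg gives cs ⊑ ceg.
  common-pump : ∀ {z : Word l} a c e g → z ⊑ (a ++ g) → z ⊑ (a ++ c ++ g) → z ⊑ (a ++ e ++ g) →
    z ⊑ (a ++ c ++ e ++ g)
  common-pump {z} a c e g h hc he with ⊑-compare h (⊑-++ a g)
  ... | inj₁ z⊑a = ⊑-trans z⊑a (⊑-++ a _)
  ... | inj₂ a⊑z with s , refl ← ⊑⇒++ a⊑z =
    ⊑-++⁺ a (⊑-trans (cycle c (⊑-++⁻ a hc)) (⊑-++⁺ c (⊑-++⁻ a he)))
    where
    s⊑g : s ⊑ g
    s⊑g = ⊑-++⁻ a h
    cycle : ∀ c → s ⊑ (c ++ g) → s ⊑ (c ++ s)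
    cycle c h = ⊑-length h (⊑-++⁺ c s⊑g) (subst (length s ≤_) (sym (length-++ c)) (ℕₚ.m≤n+m _ (length c)))

  ShortCommon : (w u : Word k) → Word l → Set
  ShortCommon w u z = ∀ {v} → length v ≤ tripleBound → Close f v w → ∀ {y} → graph (u ++ v) y → z ⊑ y

  shortCommon⇒common : ∀ {w u z} → ShortCommon w u z → Common (ClassOutput w u) z
  shortCommon⇒common {w} {u} {z} short y (v , c , g) =
    length-induction {P = λ v → Close f v w → ∀ {y} → graph (u ++ v) y → z ⊑ y}
      (λ v shorter → extend v shorter (length v ℕₚ.≤? tripleBound)) v c g
    where
    extend : ∀ v → (∀ v′ → length v′ < length v → Close f v′ w → ∀ {y} → graph (u ++ v′) y → z ⊑ y) →
      Dec (length v ≤ tripleBound) → Close f v w → ∀ {y} → graph (u ++ v) y → z ⊑ y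
    extend v shorter (yes h) cl g = short h cl g
    extend v shorter (no ¬h) cl g
      with p , d , b , r , acc , refl ← graph-elim u g
      with mkTriple {a = a} {c} {e} {g} l₀ l₁ l₂ c₀ c₁ c₂ refl _ (h₀ , _) (h₁ , _) (h₂ , _)
             ← find-triple (ℕₚ.<⇒≤ (ℕₚ.≰⇒> ¬h)) (acc , acc)
      = subst (z ⊑_) (++-assoc d a (c ++ e ++ g)) (common-pump (d ++ a) c e g
          (prefix l₀ c₀ a g h₀) (prefix l₁ c₁ a (c ++ g) h₁) (prefix l₂ c₂ a (e ++ g) h₂))
      where
      prefix : ∀ {v′} → length v′ < length v → Close f v′ v → ∀ a g → Accepts p v′ (a ++ g) → z ⊑ ((d ++ a) ++ g)
      prefix l c a g h = subst (z ⊑_) (sym (++-assoc d a g)) (shorter _ l (Close.trans c cl) (graph-intro r h))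

  opaque
    common? : ∀ w u z → Dec (Common (ClassOutput w u) z)
    common? w u z = map′ shortCommon⇒common back shortCommon?
      where
      back : Common (ClassOutput w u) z → ShortCommon w u z
      back h {v} _ c {y} g = h y (v , c , g)
      shortCommon? : Dec (ShortCommon w u z)
      shortCommon? = listable-∀? (listable-words tripleBound) λ v _ → close? v w →-dec
        listable-∀? (outputs (u ++ v)) λ y _ → z ⊑? y

  opaque
    hat : ∀ w u → ∃ (HatF f w u)
    hat w u = search (dom? (u ++ w))
      where
      -- The class of `w` has a common domain behind `u`, so emptiness of the set is decided at
      -- `u ++ w`.
      nonempty : ∀ {y} → ClassOutput w u y → Dom (u ++ w)
      nonempty (v , c , g) = to (proj₁ (close-++ˡ u c) []) (_ , g)
      search : Dec (Dom (u ++ w)) → ∃ (HatF f w u)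
      search (yes (y , g)) =
        lcp-search {M = λ A → A} (λ a → a) (λ a h → h a) {L = ClassOutput w u}
          (common? w u) (w , Close.refl , g)
      search (no ¬d) = [] , inj₂ ((λ (y , o) → ¬d (nonempty o)) , refl)

  -- From an aperiodic transducer to the canonical bimachine

  module Aperiodic {n : ℕ} (aperiodic : ∀ w → TransitionCongruence underlying (w ^ n) (w ^ suc n)) where

    SameRuns : Word k → Word k → Set
    SameRuns u v = ∀ {p q} → (∃[ a ] OutputRun p u a q) ⇔ (∃[ a ] OutputRun p v a q)

    sameRuns-++ʳ : ∀ {u v} w → SameRuns u v → SameRuns (u ++ w) (v ++ w)
    sameRuns-++ʳ {u} {v} w s = mk⇔ (extend {u} s) (extend {v} (⇔.sym s))
      where
      extend : ∀ {u v} → SameRuns u v →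
        ∀ {p q} → ∃[ a ] OutputRun p (u ++ w) a q → ∃[ a ] OutputRun p (v ++ w) a q
      extend {u} s (_ , r) =
        let (_ , a , b , r₁ , r₂ , _) = run-split u r
            (a′ , r₁′) = to s (a , r₁)
        in a′ ++ b , run-++ r₁′ r₂

    same-power : ∀ w m → n ≤ m → SameRuns (w ^ m) (w ^ suc m)
    same-power w m n≤m with d , refl ← ℕₚ.m≤n⇒∃[o]m+o≡n n≤m =
      subst₂ (λ u v → SameRuns u v) (sym (^-+ w n d)) (sym (^-+ w (suc n) d))
        (sameRuns-++ʳ (w ^ d) (⇔.trans (⇔.sym (underlying-run T)) (⇔.trans (aperiodic w _ _) (underlying-run T))))

    sameRuns⇒close : ∀ {u v} w → SameRuns u v → Close f (u ++ w) (v ++ w)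
    sameRuns⇒close {u} {v} w s = sameAccept⇒close λ p → mk⇔ (accept {u} s) (accept {v} (⇔.sym s))
      where
      accept : ∀ {u v} → SameRuns u v → ∀ {p} → ∃ (Accepts p (u ++ w)) → ∃ (Accepts p (v ++ w))
      accept {u} s (_ , acc) =
        let (_ , c , d , r , acc′ , _) = accept-split u acc
            (c′ , r′) = to s (c , r)
        in c′ ++ d , accept-++ r′ acc′

    close-power : ∀ w q → Close f ((w ^ n) ++ q) ((w ^ suc n) ++ q)
    close-power w q = sameRuns⇒close q (same-power w n ℕₚ.≤-refl)

    regroup : ∀ (u x y z v : Word k) → (u ++ x) ++ y ++ z ++ v ≡ (u ++ x ++ y ++ z) ++ v
    regroup u x y z v = trans (++-assoc u x _) (trans (cong (u ++_)
      (trans (sym (cong (x ++_) (++-assoc y z v))) (sym (++-assoc x (y ++ z) v))))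
      (sym (++-assoc u _ v)))

    -- A pair of runs on a large power of w contains a loop on some w^j with j ≥ n, which
    -- by aperiodicity can be replaced by a loop on w^(1+j); neither loop affects delays.
    power-delay : ∀ u w {v v′} → Close f v v′ → ∀ {x x′ y y′} →
      let P = (w ^ suc n) ^ suc loopBound in
      graph ((u ++ P) ++ v) x → graph ((u ++ P) ++ v′) x′ →
      graph ((u ++ w ++ P) ++ v) y → graph ((u ++ w ++ P) ++ v′) y′ → SameDelay x x′ y y′
    power-delay u w {v} {v′} cl {x} {x′} {y} {y′} gx gx′ gy gy′
      with P ← (w ^ suc n) ^ suc loopBound | powersP ← powers (w ^ suc n) (suc loopBound)
      with p , a , _ , ra , acc , _ ← graph-elim u (subst (λ t → graph t x) (++-assoc u P v) gx)
         | p′ , a′ , _ , ra′ , acc′ , _ ← graph-elim u (subst (λ t → graph t x′) (++-assoc u P v′) gx′)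
      with q , _ , d , r , accd , _ ← accept-split P acc
         | q′ , _ , d′ , r′ , accd′ , _ ← accept-split P acc′
      with mkPairLoop {i} {j} {X} {Y} {Z} {e} {e′} {g} {g′} {h} {h′} {s} {s′}
             0<j _ bX bY P≡ _ _ (rX , rX′) (rY , rY′) (rZ , rZ′)
             ← find-loop (ℕₚ.n≤1+n loopBound) powersP (r , r′)
      = result (to longer (_ , rY)) (to longer (_ , rY′))
      where
      Y≡ : Y ≡ w ^ (j * suc n)
      Y≡ = trans (powers-≡ bY) (^-* w (suc n) j)
      n≤ : n ≤ j * suc n
      n≤ = ℕₚ.≤-trans (ℕₚ.n≤1+n n) (ℕₚ.m≤n*m (suc n) j {{>-nonZero 0<j}})
      longer : SameRuns Y (w ++ Y)
      longer {s} {t} = subst (λ Y → (∃[ a ] OutputRun s Y a t) ⇔ (∃[ a ] OutputRun s (w ++ Y) a t)) (sym Y≡)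
        (same-power w (j * suc n) n≤)
      -- `X` is a power of `w`, so the additional `w` in front moves past it into the loop.
      wP≡ : w ++ P ≡ X ++ (w ++ Y) ++ Z
      wP≡ = trans (cong (w ++_) P≡) (trans (sym (++-assoc w X (Y ++ Z)))
        (trans (cong (_++ Y ++ Z) (trans (cong (w ++_) X≡) (trans (^-suc w (i * suc n)) (cong (_++ w) (sym X≡)))))
          (trans (++-assoc X w (Y ++ Z)) (cong (X ++_) (sym (++-assoc w Y Z))))))
        where
        X≡ : X ≡ w ^ (i * suc n)
        X≡ = trans (powers-≡ bX) (^-* w (suc n) i)
      output : ∀ {L G} → OutputRun s L G s → graph ((u ++ X ++ L ++ Z) ++ v) ((a ++ e) ++ G ++ h ++ d)
      output {L} rL = subst (λ t → graph t _) (regroup u X L Z v)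
        (graph-intro (reach-++ ra rX) (accept-++ rL (accept-++ rZ accd)))
      output′ : ∀ {L G} → OutputRun s′ L G s′ → graph ((u ++ X ++ L ++ Z) ++ v′) ((a′ ++ e′) ++ G ++ h′ ++ d′)
      output′ {L} rL = subst (λ t → graph t _) (regroup u X L Z v′)
        (graph-intro (reach-++ ra′ rX′) (accept-++ rL (accept-++ rZ′ accd′)))
      same-loop : ∀ {L G G′} → PairRun s s′ L G G′ s s′ →
        SameDelay (a ++ e) (a′ ++ e′) ((a ++ e) ++ G) ((a′ ++ e′) ++ G′)
      same-loop rL = close-twin (close-++ˡ Z cl) (reach-++ ra rX) (reach-++ ra′ rX′) rL
                       (accept-++ rZ accd) (accept-++ rZ′ accd′)
      result : ∃[ G ] OutputRun s (w ++ Y) G s → ∃[ G ] OutputRun s′ (w ++ Y) G s′ → SameDelay x x′ y y′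
      result (G , rwY) (G′ , rwY′)
        with refl ← functional gx (subst (λ t → graph ((u ++ t) ++ v) _) (sym P≡) (output rY))
           | refl ← functional gx′ (subst (λ t → graph ((u ++ t) ++ v′) _) (sym P≡) (output′ rY′))
           | refl ← functional gy (subst (λ t → graph ((u ++ t) ++ v) _) (sym wP≡) (output rwY))
           | refl ← functional gy′ (subst (λ t → graph ((u ++ t) ++ v′) _) (sym wP≡) (output′ rwY′))
        = subst₂ (λ s t → SameDelay s t ((a ++ e) ++ G ++ h ++ d) ((a′ ++ e′) ++ G′ ++ h′ ++ d′))
            (++-assoc (a ++ e) g (h ++ d)) (++-assoc (a′ ++ e′) g′ (h′ ++ d′))
            (subst₂ (SameDelay (((a ++ e) ++ g) ++ h ++ d) (((a′ ++ e′) ++ g′) ++ h′ ++ d′))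
              (++-assoc (a ++ e) G (h ++ d)) (++-assoc (a′ ++ e′) G′ (h′ ++ d′))
              (sd-++ʳ (h ++ d) (h′ ++ d′)
                (sd-trans (sd-sym (same-loop (rY , rY′))) (same-loop (rwY , rwY′)))))

    -- More than `loopBound` blocks force a loop over `j` > 0 whole blocks. Each block is w^(n+1),
    -- so that the loop reads a power with exponent at least `n`, where `same-power` applies.
    simD-power : ∀ w u → let m = suc loopBound * suc n in SimD (u ++ (w ^ m)) (u ++ (w ^ suc m))
    simD-power w u = subst (λ P → SimD (u ++ P) (u ++ w ++ P)) (^-* w (suc n) (suc loopBound))
      ( (λ v → subst₂ (λ s t → Dom s ⇔ Dom t) (sym (++-assoc u P v)) (sym (++-assoc u (w ++ P) v))
          (proj₁ (close-++ˡ u (sameRuns⇒close v same)) []))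
      , power-delay u w)
      where
      m : ℕ
      m = suc loopBound * suc n
      P : Word k
      P = (w ^ suc n) ^ suc loopBound
      same : SameRuns P (w ++ P)
      same {p} {q} = subst (λ P → (∃[ a ] OutputRun p P a q) ⇔ (∃[ a ] OutputRun p (w ++ P) a q))
        (sym (^-* w (suc n) (suc loopBound)))
        (same-power w m (ℕₚ.≤-trans (ℕₚ.n≤1+n n) (ℕₚ.m≤m+n (suc n) _)))

when : {A B : Set} → Dec A → (A → B) → Maybe B
when (yes a) f = just (f a)
when (no _)  f = nothing

when-just : ∀ {A B : Set} (a? : Dec A) {f : A → B} {b} → when a? f ≡ just b → ∃[ a ] b ≡ f a
when-just (yes a) refl = a , refl

when-yes : ∀ {A B : Set} (a? : Dec A) {f : A → B} → A → ∃[ b ] when a? f ≡ just b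
when-yes (yes a) {f} _ = f a , refl
when-yes (no ¬a)     a = ⊥-elim (¬a a)

drop-prefix : ∀ {l} {p y : Word l} → p ⊑ y → y ≡ p ++ drop (length p) y
drop-prefix {p = p} p⊑y with r , refl ← ⊑⇒++ p⊑y = cong (p ++_) (sym (drop-++ p r))
  where
  drop-++ : ∀ {l} (p r : Word l) → drop (length p) (p ++ r) ≡ r
  drop-++ []      r = refl
  drop-++ (a ∷ p) r = drop-++ p r

module CanonicalTransducer {k l : ℕ} (f : Transduction k l) (T : Transducer k l) (realizes : Realizes T f) where
  open Transduction f
  open Canonical f
  open Realization f T realizes
    using (dom?; leftBound; rightBound; left-rep; right-rep; close?; simD?; hat)
  -- The canonical bimachine as a transducer

  prefixOf : Word k → Word k → Word l
  prefixOf w u = proj₁ (hat w u)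

  -- A total version of the quotient f̂_[w](u)⁻¹y, meaningful where f̂_[w](u) is a prefix of `y`.
  rest : Word k → Word k → Word l → Word l
  rest w u y = drop (length (prefixOf w u)) y

  rest-≡ : ∀ {u w y} → graph (u ++ w) y → y ≡ prefixOf w u ++ rest w u y
  rest-≡ {u} {w} g = drop-prefix (lcp-common (proj₂ (hat w u)) (w , Close.refl , g) _ (w , Close.refl , g))

  rest-residual : ∀ {u w y} → graph (u ++ w) y → Residual f u w (rest w u y)
  rest-residual {u} {w} g = prefixOf w u , proj₂ (hat w u) , subst (graph (u ++ w)) (rest-≡ g) g

  residual-graph : ∀ {u w r} → Residual f u w r → graph (u ++ w) (prefixOf w u ++ r)
  residual-graph {u} {w} {r} (p , P , g) =
    subst (λ p → graph (u ++ w) (p ++ r)) (hat-unique P (proj₂ (hat w u)) (_ , g)) g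

  prefix-cong : ∀ {w w′ u} → Close f w w′ → Dom (u ++ w) → prefixOf w u ≡ prefixOf w′ u
  prefix-cong {w} {w′} {u} c d = hat-unique (proj₂ (hat w u)) (hat-cong (Close.sym c) (proj₂ (hat w′ u))) d

  -- The output ω_f([u], σ, [w]) of the canonical bimachine, computed from representatives.
  emission : Word k → Fin k → Word k → Word l
  emission u σ w = rest (σ ∷ w) u (prefixOf w (u ++ [ σ ]))

  module _ (u : Word k) (σ : Fin k) where

    shiftʳ : ∀ {w y} → graph (u ++ σ ∷ w) y → graph ((u ++ [ σ ]) ++ w) y
    shiftʳ {w} {y} = subst (λ t → graph t y) (sym (++-assoc u [ σ ] w))

    shiftˡ : ∀ {w y} → graph ((u ++ [ σ ]) ++ w) y → graph (u ++ σ ∷ w) y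
    shiftˡ {w} {y} = subst (λ t → graph t y) (++-assoc u [ σ ] w)

    emission-≡ : ∀ {w} → Dom (u ++ σ ∷ w) → prefixOf w (u ++ [ σ ]) ≡ prefixOf (σ ∷ w) u ++ emission u σ w
    emission-≡ {w} (y , g) = drop-prefix (lcp-greatest (proj₂ (hat w (u ++ [ σ ])))
      (w , Close.refl , shiftʳ g) _ λ x (v , c , gx) →
        lcp-common (proj₂ (hat (σ ∷ w) u)) (σ ∷ w , Close.refl , g) x (σ ∷ v , close-++ˡ [ σ ] c , shiftˡ gx))

  -- The residuals of f(uσw) before and after reading σ differ by the emission and depend
  -- only on the class of u.
  emission-cong : ∀ {u z σ w w′} → SimD u z → Close f w w′ → Dom (z ++ σ ∷ w′) →
    prefixOf (σ ∷ w′) z ++ emission u σ w ≡ prefixOf w′ (z ++ [ σ ])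
  emission-cong {u} {z} {σ} {w} {w′} s c (y , g)
    with x , gx ← from (proj₁ s (σ ∷ w′)) (y , g)
    = ++-cancelʳ r₂ _ _ (trans (++-assoc (prefixOf (σ ∷ w′) z) (emission u σ w) r₂)
        (trans (cong (prefixOf (σ ∷ w′) z ++_) (sym r₁≡))
          (functional (residual-graph (simD-residual s (rest-residual gx)))
            (shiftˡ z σ (residual-graph (simD-residual (simD-++ʳ [ σ ] s) (rest-residual (shiftʳ u σ gx))))))))
    where
    d : Dom (u ++ σ ∷ w)
    d = from (proj₁ (close-++ˡ u (close-++ˡ [ σ ] c)) []) (x , gx)
    emits : prefixOf w′ (u ++ [ σ ]) ≡ prefixOf (σ ∷ w′) u ++ emission u σ w
    emits = trans (sym (prefix-cong c (_ , shiftʳ u σ (proj₂ d)))) (trans (emission-≡ u σ d)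
      (cong (_++ emission u σ w) (prefix-cong (close-++ˡ [ σ ] c) d)))
    r₁ r₂ : Word l
    r₁ = rest (σ ∷ w′) u x
    r₂ = rest w′ (u ++ [ σ ]) x
    r₁≡ : r₁ ≡ emission u σ w ++ r₂
    r₁≡ = ++-cancelˡ (prefixOf (σ ∷ w′) u) _ _ (trans (sym (rest-≡ gx)) (trans (rest-≡ (shiftʳ u σ gx))
      (trans (cong (_++ r₂) emits) (++-assoc (prefixOf (σ ∷ w′) u) (emission u σ w) r₂))))

  ShortPair : Word k × Word k → Set
  ShortPair (u , w) = length u ≤ leftBound × length w ≤ rightBound

  opaque
    shortPairs : Listable ShortPair
    shortPairs = listable-Σ (listable-words leftBound) λ _ → listable-words rightBound

  State : Set
  State = Fin (length (proj₁ shortPairs))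

  leftWord rightWord : State → Word k
  leftWord i  = proj₁ (lookup (proj₁ shortPairs) i)
  rightWord i = proj₂ (lookup (proj₁ shortPairs) i)

  opaque
    state : ∀ u w → ∃[ i ] (SimD u (leftWord i) × Close f (rightWord i) w)
    state u w
      with u₀ , u≤ , s ← left-rep u | w₀ , w≤ , c ← right-rep w
      = Any.index uw∈ , subst (λ uw → SimD u (proj₁ uw) × Close f (proj₂ uw) w) (lookup-index uw∈)
          (simD-sym s , c)
      where
      uw∈ : (u₀ , w₀) ∈ proj₁ shortPairs
      uw∈ = from (proj₂ shortPairs) (u≤ , w≤)

  -- The left word follows the class of the input read so far. The right word guesses the class of
  -- the input still to come, and each step checks the guess backwards, as the right automaton
  -- reads.
  Step : State → Fin k → State → Set
  Step i σ j = SimD (leftWord i ++ [ σ ]) (leftWord j) × Close f (rightWord i) (σ ∷ rightWord j)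

  step? : ∀ i σ j → Dec (Step i σ j)
  step? i σ j = simD? _ _ ×-dec close? _ _

  initial? : ∀ i → Dec (SimD [] (leftWord i))
  initial? i = simD? _ _

  final? : ∀ i → Dec (Close f (rightWord i) [] × Dom (leftWord i))
  final? i = close? _ _ ×-dec dom? _

  bimachine : Transducer k l
  bimachine = record
    { size  = length (proj₁ shortPairs)
    ; δ     = λ i σ j → when (step? i σ j) λ _ → emission (leftWord i) σ (rightWord j)
    ; init  = λ i → when (initial? i) λ _ → prefixOf (rightWord i) []
    ; final = λ i → when (final? i) λ (_ , (y , _)) → rest [] (leftWord i) y
    }

  open Transducer bimachine using (OutputRun; done; step; ⟦_⟧)

  Path : State → Word k → State → Set
  Path i x j = SimD (leftWord i ++ x) (leftWord j) × Close f (rightWord i) (x ++ rightWord j)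

  run⇒path : ∀ {i x o j} → OutputRun i x o j → Path i x j
  run⇒path {i} done = subst (λ u → SimD u (leftWord i)) (sym (++-identityʳ (leftWord i))) simD-refl , Close.refl
  run⇒path {i} {j = j} (step {σ = σ} {r = h} {u = x} d r)
    with (s , c) , _ ← when-just (step? i σ h) d | s′ , c′ ← run⇒path r
    = subst (λ u → SimD u (leftWord j)) (++-assoc (leftWord i) [ σ ] x) (simD-trans (simD-++ʳ x s) s′)
    , Close.trans c (close-++ˡ [ σ ] c′)

  -- Only for nonempty words: distinct states may represent the same classes.
  path⇒run : ∀ σ x {i j} → Path i (σ ∷ x) j → ∃[ o ] OutputRun i (σ ∷ x) o j
  path⇒run σ [] {i} {j} p with o , d ← when-yes (step? i σ j) p = _ , step d done
  path⇒run σ (τ ∷ x) {i} {j} (s , c)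
    with h , s₁ , c₁ ← state (leftWord i ++ [ σ ]) (τ ∷ x ++ rightWord j)
    with o , d ← when-yes (step? i σ h) (s₁ , Close.trans c (close-++ˡ [ σ ] (Close.sym c₁)))
       | _ , r ← path⇒run τ x {h} {j} (simD-trans (simD-++ʳ (τ ∷ x) (simD-sym s₁))
                   (subst (λ u → SimD u (leftWord j)) (sym (++-assoc (leftWord i) [ σ ] (τ ∷ x))) s) , c₁)
    = _ , step d r

  -- The emissions telescope. The words `z` and `t` are the actual surroundings of `x`, for which
  -- the states carry mere representatives; `emission-cong` passes from the ones to the others.
  run-output : ∀ {i x o j z t} → OutputRun i x o j → SimD (leftWord i) z → Close f (rightWord j) t →
    Dom (z ++ x ++ t) → prefixOf (x ++ t) z ++ o ≡ prefixOf t (z ++ x)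
  run-output {z = z} {t} done _ _ _ = trans (++-identityʳ _) (cong (prefixOf t) (sym (++-identityʳ z)))
  run-output {i} {z = z} {t} (step {σ = σ} {r = h} {u = x} {x = o} d r) s c dom
    with (s₁ , c₁) , refl ← when-just (step? i σ h) d
    = begin
      prefixOf (σ ∷ x ++ t) z ++ e ++ o    ≡⟨ ++-assoc (prefixOf (σ ∷ x ++ t) z) e o ⟨
      (prefixOf (σ ∷ x ++ t) z ++ e) ++ o  ≡⟨ cong (_++ o) (emission-cong s closeₕ dom) ⟩
      prefixOf (x ++ t) (z ++ [ σ ]) ++ o
        ≡⟨ run-output r (simD-trans (simD-sym s₁) (simD-++ʳ [ σ ] s)) c
             (subst Dom (sym (++-assoc z [ σ ] (x ++ t))) dom) ⟩
      prefixOf t ((z ++ [ σ ]) ++ x)       ≡⟨ cong (prefixOf t) (++-assoc z [ σ ] x) ⟩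
      prefixOf t (z ++ σ ∷ x)              ∎
    where
    open ≡-Reasoning
    e : Word l
    e = emission (leftWord i) σ (rightWord h)
    closeₕ : Close f (rightWord h) (x ++ t)
    closeₕ = Close.trans (proj₂ (run⇒path r)) (close-++ˡ x c)

  sound : ∀ {x y} → ⟦ x ⟧ y → graph x y
  sound {x} (i , j , _ , o , _ , hi , r , hf , refl)
    with s , refl ← when-just (initial? i) hi
       | (c , (y , g)) , refl ← when-just (final? j) hf
    = subst₂ graph (++-identityʳ x) outputs≡ (residual-graph (simD-residual (simD-sym sₓ) (rest-residual g′)))
    where
    g′ : graph (leftWord j ++ []) y
    g′ = subst (λ u → graph u y) (sym (++-identityʳ (leftWord j))) g
    sₓ : SimD x (leftWord j)
    sₓ = simD-trans (simD-++ʳ x s) (proj₁ (run⇒path r))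
    cₓ : Close f (rightWord i) (x ++ [])
    cₓ = Close.trans (proj₂ (run⇒path r)) (close-++ˡ x c)
    dom : Dom (x ++ [])
    dom = from (proj₁ sₓ []) (y , g′)
    t : Word l
    t = rest [] (leftWord j) y
    outputs≡ : prefixOf [] x ++ t ≡ prefixOf (rightWord i) [] ++ o ++ t
    outputs≡ = begin
      prefixOf [] x ++ t                     ≡⟨ cong (_++ t) (run-output r (simD-sym s) c dom) ⟨
      (prefixOf (x ++ []) [] ++ o) ++ t      ≡⟨ ++-assoc (prefixOf (x ++ []) []) o t ⟩
      prefixOf (x ++ []) [] ++ o ++ t        ≡⟨ cong (_++ o ++ t) (prefix-cong cₓ (from (proj₁ cₓ []) dom)) ⟨
      prefixOf (rightWord i) [] ++ o ++ t    ∎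
      where open ≡-Reasoning

  complete : ∀ {x y} → graph x y → ⟦ x ⟧ y
  complete {x} {y} g = accepting x g
    where
    accept : ∀ {x y i j o} → graph x y → SimD [] (leftWord i) → OutputRun i x o j →
      SimD x (leftWord j) → Close f (rightWord j) [] → ⟦ x ⟧ y
    accept {x} {y} {i} {j} {o} g s r sₓ c =
      -- The output needs no computation: by `sound` it is a value of f at `x`, and f has one value
      -- there.
      subst ⟦ x ⟧ (functional (sound result) g) result
      where
      dom : Dom (leftWord j)
      dom = subst Dom (++-identityʳ (leftWord j))
              (to (proj₁ sₓ []) (y , subst (λ u → graph u y) (sym (++-identityʳ x)) g))
      result : ⟦ x ⟧ (proj₁ (when-yes (initial? i) {λ _ → prefixOf (rightWord i) []} s) ++ o ++
                      proj₁ (when-yes (final? j) {λ (_ , (y , _)) → rest [] (leftWord j) y} (c , dom)))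
      result = i , j , _ , o , _ , proj₂ (when-yes (initial? i) s) ,
               r , proj₂ (when-yes (final? j) (c , dom)) , refl
    accepting : ∀ x {y} → graph x y → ⟦ x ⟧ y
    -- A run on the empty word does not move, so a single state has to be both initial and final.
    accepting [] g = let (i , s , c) = state [] [] in accept g s done s c
    accepting (σ ∷ x) g =
      let (i , s , c)   = state [] (σ ∷ x)
          (j , s′ , c′) = state (σ ∷ x) []
          (o , r) = path⇒run σ x {i} {j}
            ( simD-trans (simD-++ʳ (σ ∷ x) (simD-sym s)) s′
            , Close.trans c (subst (λ w → Close f w (σ ∷ x ++ rightWord j)) (++-identityʳ (σ ∷ x))
                (close-++ˡ (σ ∷ x) (Close.sym c′))))
      in accept g s r s′ c′

  bimachine-realizes : Realizes bimachine f
  bimachine-realizes x y = mk⇔ sound complete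

  -- Aperiodicity of the finite transducer

  module _ (m n : ℕ) (left : ∀ w u → SimD (u ++ (w ^ m)) (u ++ (w ^ suc m)))
                     (right : ∀ w v → Close f ((w ^ n) ++ v) ((w ^ suc n) ++ v)) where

    private
      -- The successor makes powers of nonempty words nonempty.
      N : ℕ
      N = suc (m + n)

    left-power : ∀ w u → SimD (u ++ (w ^ N)) (u ++ (w ^ suc N))
    left-power w u = subst₂ SimD (split m) (split (suc m)) (simD-++ʳ (w ^ suc n) (left w u))
      where
      split : ∀ m → (u ++ (w ^ m)) ++ (w ^ suc n) ≡ u ++ (w ^ suc (m + n))
      split m = trans (++-assoc u (w ^ m) _) (cong (u ++_)
        (trans (sym (^-+ w m (suc n))) (cong (w ^_) (ℕₚ.+-suc m n))))

    right-power : ∀ w v → Close f ((w ^ N) ++ v) ((w ^ suc N) ++ v)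
    right-power w v = subst₂ (Close f) (split n)
      (trans (split (suc n)) (cong (λ e → (w ^ e) ++ v) (ℕₚ.+-suc (suc m) n))) (close-++ˡ (w ^ suc m) (right w v))
      where
      split : ∀ n → (w ^ suc m) ++ (w ^ n) ++ v ≡ (w ^ (suc m + n)) ++ v
      split n = trans (sym (++-assoc (w ^ suc m) (w ^ n) v)) (cong (_++ v) (sym (^-+ w (suc m) n)))

    bimachine-aperiodic : AperiodicAutomaton (Transducer.underlying bimachine)
    bimachine-aperiodic = N , λ w i j → ⇔.trans (underlying-run bimachine)
      (⇔.trans (same w i j) (⇔.sym (underlying-run bimachine)))
      where
      same : ∀ w i j → (∃[ o ] OutputRun i (w ^ N) o j) ⇔ (∃[ o ] OutputRun i (w ^ suc N) o j)
      same [] i j = subst₂ (λ u v → (∃[ o ] OutputRun i u o j) ⇔ (∃[ o ] OutputRun i v o j))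
        (sym ([]-^ N)) (sym ([]-^ (suc N))) ⇔.refl
        where
        []-^ : ∀ n → _^_ {k} [] n ≡ []
        []-^ zero    = refl
        []-^ (suc n) = []-^ n
      same w@(σ ∷ x) i j = mk⇔
        (λ (_ , r) → let (s , c) = run⇒path r in path⇒run σ (x ++ (w ^ N)) {i} {j}
          (simD-trans (simD-sym (left-power w (leftWord i))) s , Close.trans c (right-power w (rightWord j))))
        (λ (_ , r) → let (s , c) = run⇒path r in path⇒run σ (x ++ (w ^ (m + n))) {i} {j}
          (simD-trans (left-power w (leftWord i)) s , Close.trans c (Close.sym (right-power w (rightWord j)))))

theorem5p4 : ∀ {k l : ℕ} (f : Transduction k l) → Rational f →
    ApRational f ⇔ AperiodicBimachine (canonicalBimachine f)
theorem5p4 f (T , _ , realizes) = mk⇔ forth back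
  where
  open Canonical f
  forth : ApRational f → AperiodicBimachine (canonicalBimachine f)
  forth (A , _ , realizesᴬ , n , aperiodic) =
    from left-aperiodic (suc loopBound * suc n , simD-power) , from right-aperiodic (n , close-power)
    where
    open Realization f A realizesᴬ using (loopBound)
    open Realization.Aperiodic f A realizesᴬ {n} aperiodic
  back : AperiodicBimachine (canonicalBimachine f) → ApRational f
  back (left , right) = bimachine ,
    (λ x x′ → Transduction.functional f (to (bimachine-realizes _ _) x) (to (bimachine-realizes _ _) x′)) ,
    bimachine-realizes ,
    bimachine-aperiodic (proj₁ (to left-aperiodic left)) (proj₁ (to right-aperiodic right))
      (proj₂ (to left-aperiodic left)) (proj₂ (to right-aperiodic right))
    where
    open CanonicalTransducer f T realizes
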